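{- Let $x, y$ be nonnegative coprime integers which satisfy one of the following conditions: \begin{itemize} \item $y$ is odd and $\left(\frac{x}{y}\right)=-1$; \item $(x, y)\equiv (1, 0)\pmod{4}$ and $\left(\frac{x}{y}\right)=-1$; \item $(x, y)\equiv (3, 0)\pmod{4}$, and $\left(\frac{x}{y}\right)=-\left(\frac{ -1}{y}\right)$. \end{itemize} Then the numerators and denominators of the orbit $\Psi\begin{pmatrix} x\\ y\end{pmatrix}$ cannot be squares.
   Context: $\left(\frac{x}{y}\right)$ denotes the Kronecker symbol. For a subset $\Gamma\subseteq\mathrm{SL}(2,\mathbb{Z})$, $\Gamma^{\geq 0}$ denotes the matrices in $\Gamma$ with all entries nonnegative. $\Gamma_1(4)=\{\begin{pmatrix} a & b\\ c & d\end{pmatrix}\in\mathrm{SL}(2,\mathbb{Z}): a\equiv d\equiv 1 \pmod 4,\ c\equiv 0\pmod 4\}$. The semigroup $\Psi$ is defined as the set of $\begin{pmatrix} a & b\\ c & d\end{pmatrix}\in\Gamma_1(4)^{\geq 0}$ such that for all nonnegative integers $x,y$ with $y$ odd, $\left(\frac{x}{y}\right)=\left(\frac{ax+by}{cx+dy}\right)$; equivalently, it is the set of such matrices with $\left(\frac{a}{b}\right)=1$. For a vector $\begin{pmatrix} u\\ v\end{pmatrix}$ in an orbit $\Psi\begin{pmatrix} x\\ y\end{pmatrix}=\{\gamma\begin{pmatrix} x\\ y\end{pmatrix}:\gamma\in\Psi\}$, $u$ is called the numerator and $v$ the denominator. -}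

module Defs where

open import Data.Bool using (Bool; true; false; if_then_else_; _∧_; _∨_)
open import Data.Nat using (ℕ; zero; suc; _+_; _*_; _∸_; _%_; _/_; _≡ᵇ_)
open import Data.Nat.Coprimality using (Coprime)
open import Data.Integer using (ℤ; +_; -[1+_]; -_) renaming (_*_ to _*ℤ_)
open import Data.Integer.DivMod using (_%ℕ_)
open import Data.List using (upTo)
open import Data.Bool.ListAction using (any)
open import Data.Product using (∃; _×_)
open import Relation.Binary.PropositionalEquality using (_≡_)

-- The Kronecker symbol (a / n) for a ∈ ℤ and n ∈ ℕ (n ≥ 0 suffices here).
--   (a/0) = 1 if a = ±1, else 0;   (a/1) = 1;
--   (a/2) = 0 if a even, 1 if a ≡ ±1 (mod 8), -1 if a ≡ ±3 (mod 8);
--   (a/p) = Legendre symbol for p an odd prime;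
--   completely multiplicative in n: (a/n) = (a/p)(a/(n/p)) for a prime p ∣ n.

isSquareMod : ℕ → ℕ → Bool
isSquareMod p r = any (λ x → ((x * x) % suc (p ∸ 1)) ≡ᵇ r) (upTo p)

legendre : ℕ → ℤ → ℤ
legendre zero    a = + 0
legendre (suc q) a =
  let r = a %ℕ (suc q) in
  if r ≡ᵇ 0 then + 0 else (if isSquareMod (suc q) r then + 1 else -[1+ 0 ])

kron2 : ℤ → ℤ
kron2 a =
  let r = a %ℕ 8 in
  if (r ≡ᵇ 1) ∨ (r ≡ᵇ 7) then + 1
  else (if (r ≡ᵇ 3) ∨ (r ≡ᵇ 5) then -[1+ 0 ] else + 0)

kronPrime : ℕ → ℤ → ℤ
kronPrime p a = if p ≡ᵇ 2 then kron2 a else legendre p a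

-- least divisor d ≥ 2 of n (searching d, d+1, … with fuel); it is prime for n ≥ 2
minFactorFrom : ℕ → ℕ → ℕ → ℕ
minFactorFrom zero    d n = n
minFactorFrom (suc k) d n = if (n % suc (d ∸ 1)) ≡ᵇ 0 then d else minFactorFrom k (suc d) n

minFactor : ℕ → ℕ
minFactor n = minFactorFrom n 2 n

-- fuel-driven recursion on n (fuel n is enough since n / p < n)
kronAux : ℕ → ℤ → ℕ → ℤ
kronAux fuel    (+ suc zero)  zero = + 1
kronAux fuel    -[1+ zero ]   zero = + 1
kronAux fuel    a             zero = + 0
kronAux fuel    a (suc zero) = + 1
kronAux zero    a (suc (suc m)) = + 1  -- unreachable with enough fuel
kronAux (suc f) a (suc (suc m)) =
  let n = suc (suc m) ; p = minFactor n in
  kronPrime p a *ℤ kronAux f a (n / suc (p ∸ 1))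

kronecker : ℤ → ℕ → ℤ
kronecker a n = kronAux n a n

record Mat : Set where
  constructor mat
  field
    a b c d : ℕ
    det : a * d ≡ b * c + 1
open Mat public

InΓ₁4 : Mat → Set
InΓ₁4 γ = (a γ % 4 ≡ 1) × (d γ % 4 ≡ 1) × (c γ % 4 ≡ 0)

numer denom : Mat → ℕ → ℕ → ℕ
numer γ x y = a γ * x + b γ * y
denom γ x y = c γ * x + d γ * y

InΨ : Mat → Set
InΨ γ = InΓ₁4 γ ×
  ((x y : ℕ) → y % 2 ≡ 1 → kronecker (+ x) y ≡ kronecker (+ numer γ x y) (denom γ x y))

IsSquare : ℕ → Set
IsSquare n = ∃ λ k → n ≡ k * k

Cond : ℕ → ℕ → Set
Cond x y =
  Data.Sum._⊎_ ((y % 2 ≡ 1) × (kronecker (+ x) y ≡ -[1+ 0 ]))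
   (Data.Sum._⊎_ ((x % 4 ≡ 1) × (y % 4 ≡ 0) × (kronecker (+ x) y ≡ -[1+ 0 ]))
     ((x % 4 ≡ 3) × (y % 4 ≡ 0) × (kronecker (+ x) y ≡ - kronecker -[1+ 0 ] y)))
  where import Data.Sum

{-# OPTIONS --safe #-}

-- For odd y the defining property of Ψ gives (u/v) = (x/y) = −1 for the orbit vector (u , v),
-- and a symbol whose numerator or denominator is a square is never −1.
--
-- If 4 ∣ y then x is odd, and quadratic reciprocity rewrites both remaining conditions as
-- (y/x) = −1.  It then suffices that (v/u) = (y/x).  Since a v = y + c u we have
-- (a/u)(v/u) = (y/u).  Reciprocity for a ≡ 1 (mod 4) gives (a/u) = (u/a) = (b/a)(y/a), and as
-- (y/·) has period y on odd numbers, (y/u) = (y/(a x)) = (y/a)(y/x).  Finally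
-- (b/a)(b/d) = (b/(a d)) = 1 because a d = b c + 1 ≡ 1 (mod 4b), and (b/d) = (0/1) = 1 by the
-- defining property of Ψ at (0 , 1).  The factor (y/a) is cancelled after a translation making
-- a prime to y.
--
-- The Legendre symbol is tied to Gauss's lemma through Euler's criterion, whose converse half
-- is Lagrange's bound on the number of roots of X^P − 1.
module Submission where

open import Defs
open import Data.Bool using (Bool; true; false; T; if_then_else_; _∧_; _∨_)
open import Data.Integer using (ℤ; +_; -[1+_]; -_; ∣_∣; ≢-nonZero) renaming (_+_ to _+ℤ_; _*_ to _*ℤ_; _-_ to _-ℤ_; _^_ to _^ℤ_)
open import Data.Integer.DivMod using (_%ℕ_; _/ℕ_; a≡a%ℕn+[a/ℕn]*n; n%ℕd<d)
open import Data.Integer.Divisibility.Signed using (∣ᵤ⇒∣; ∣⇒∣ᵤ) renaming (_∣_ to _∣ℤ_; divides to dividesℤ; ∣m∣n⇒∣m+n to ∣ℤ-+; ∣m⇒∣-m to ∣ℤ-neg; ∣n⇒∣m*n to ∣ℤ-*ˡ; ∣m⇒∣m*n to ∣ℤ-*ʳ; ∣-trans to ∣ℤ-trans)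
import Data.Integer.Properties as ℤₚ
open import Data.Integer.Tactic.RingSolver using () renaming (solve-∀ to solveℤ-∀)
open import Data.List using (List; []; _∷_; _++_; applyUpTo; length; replicate; upTo)
open import Data.List.Membership.Propositional using (find; lose)
open import Data.List.Membership.Propositional.Properties using (∈-++⁺ʳ; ∈-++⁺ˡ; ∈-++⁻; ∈-applyUpTo⁺; ∈-applyUpTo⁻; ∈-upTo⁺; ∈-∃++)
open import Data.List.Properties using (length-applyUpTo; length-replicate)
open import Data.List.Relation.Binary.Permutation.Propositional using (_↭_; prep; ↭-refl; ↭-sym; ↭-trans)
open import Data.List.Relation.Binary.Permutation.Propositional.Properties using (shift; ↭-length)
open import Data.List.Relation.Binary.Subset.Propositional using (_⊆_)
open import Data.List.Relation.Unary.All as All using (All; []; _∷_)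
import Data.List.Relation.Unary.All.Properties as Allₚ
open import Data.List.Relation.Unary.AllPairs using (AllPairs; []; _∷_)
import Data.List.Relation.Unary.AllPairs.Properties as AllPairsₚ
open import Data.List.Relation.Unary.Any using (here; there)
open import Data.List.Relation.Unary.Any.Properties using (any⁺; any⁻)
open import Data.List.Relation.Unary.Unique.Propositional using (Unique)
import Data.List.Relation.Unary.Unique.Propositional.Properties as Uniqueₚ
open import Data.Nat using (ℕ; zero; suc; _+_; _*_; _∸_; _%_; _/_; _⊔_; _≡ᵇ_; _<ᵇ_; _≤_; _<_; z≤n; s≤s; NonZero; >-nonZero; n>1⇒nonTrivial; nonTrivial⇒n>1)
open import Data.Nat.Coprimality using (Coprime)
open import Data.Nat.DivMod using (m%n<n; m*n/n≡m; m≡m%n+[m/n]*n)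
open import Data.Nat.Divisibility using (_∣_; _∤_; _∣?_; divides; m%n≡0⇒n∣m; m∣m*n; n∣m*n; n∣m⇒m%n≡0; ∣-refl; ∣1⇒≡1; ∣m+n∣m⇒∣n; ∣m⇒∣m*n; ∣n⇒∣m*n; ∣⇒≤)
open import Data.Nat.Induction using (<-rec)
open import Data.Nat.ListAction using (product; sum)
open import Data.Nat.ListAction.Properties using (product-↭)
open import Data.Nat.Primality using (Prime; _Rough_; 2-rough; euclidsLemma; prime[2]; prime⇒irreducible; prime⇒nonTrivial; prime⇒nonZero; rough∧∣⇒prime; ¬prime[1]; ∤⇒rough-suc)
open import Data.Nat.Properties
open import Data.Nat.Tactic.RingSolver using () renaming (solve-∀ to solveℕ-∀)
open import Data.Product using (∃; _×_; _,_; proj₁; swap)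
open import Data.Sum using (_⊎_; inj₁; inj₂; [_,_]′)
open import Function using (_∘_; case_of_)
open import Relation.Binary.PropositionalEquality hiding (J)
open import Relation.Nullary using (¬_; yes; no; contradiction)

-- The defining property of `InΨ` speaks only of odd lower entries, so for 4 ∣ y it says nothing
-- about the orbit vector and invariance has to be proved anew. There u is the odd entry; the symbol
-- is therefore turned over to (v/u), a Jacobi symbol, which is multiplicative and periodic in its
-- upper entry. The factor (y/a) may vanish, since a and y can share a prime. The translation sends
-- a to a + tc and u to u + tv. As a and c are coprime by the determinant, some t makes a + tc prime
-- to y, while 4 ∣ v makes (v/·) blind to the change of u. The period is y and not 4y because (4η/n)
-- = (η/n) for odd n. For x ≡ 3 (mod 4) reciprocity carries the factor (-1/y), which explains the
-- sign in the third condition.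

≡ᵇ-true : ∀ {m n} → (m ≡ᵇ n) ≡ true → m ≡ n
≡ᵇ-true {m} {n} eq = ≡ᵇ⇒≡ m n (subst T (sym eq) _)

≡ᵇ-false : ∀ {m n} → (m ≡ᵇ n) ≡ false → m ≢ n
≡ᵇ-false {m} {n} eq m≡n = subst T eq (≡⇒≡ᵇ m n m≡n)

-- Multiplicativity of the Kronecker symbol in its lower entry

-- Roughness is the loop invariant: n has no divisor in [2, d), so the first divisor met is prime.
-- The bound n < d + k lets the search reach n itself before the fuel ends.
minFactorFrom-prime : ∀ k d n → 2 ≤ d → d ≤ n → n < d + k → d Rough n →
  Prime (minFactorFrom k d n) × minFactorFrom k d n ∣ n
minFactorFrom-prime zero d n 2≤d d≤n n<d+k r =
  contradiction (subst (n <_) (+-identityʳ d) n<d+k) (≤⇒≯ d≤n)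
minFactorFrom-prime (suc k) (suc d) n 2≤d d≤n n<d+k r with (n % suc d) ≡ᵇ 0 in eq
... | true  = rough∧∣⇒prime {{n>1⇒nonTrivial 2≤d}} r d∣n , d∣n
  where d∣n = m%n≡0⇒n∣m n (suc d) (≡ᵇ-true eq)
... | false = minFactorFrom-prime k (suc (suc d)) n (m≤n⇒m≤1+n 2≤d)
    (≤∧≢⇒< d≤n λ { refl → d∤n ∣-refl }) (subst (n <_) (+-suc (suc d) k) n<d+k) (∤⇒rough-suc d∤n r)
  where d∤n : suc d ∤ n
        d∤n d∣n = ≡ᵇ-false eq (n∣m⇒m%n≡0 n (suc d) d∣n)

minFactor-prime : ∀ n → 2 ≤ n → Prime (minFactor n) × minFactor n ∣ n
minFactor-prime n 2≤n = minFactorFrom-prime n 2 n ≤-refl 2≤n (m≤n⇒m≤1+n (n<1+n n)) 2-rough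

module _ {p} (pp : Prime p) where
  prime≥2 : 2 ≤ p
  prime≥2 = nonTrivial⇒n>1 p {{prime⇒nonTrivial pp}}

  prime>0 : 0 < p
  prime>0 = <-trans (s≤s z≤n) prime≥2

cofactor : ∀ {p n} → 2 ≤ n → Prime p → p ∣ n → ∃ λ m → n ≡ p * m × 0 < m × m < n
cofactor {p} {n} 2≤n pp (divides m eq) = m , n≡pm , 0<m , m<n
  where
  n≡pm : n ≡ p * m
  n≡pm = trans eq (*-comm m p)
  0<m : 0 < m
  0<m = n≢0⇒n>0 λ { refl → contradiction (subst (2 ≤_) eq 2≤n) λ () }
  m<n : m < n
  m<n = subst (m <_) (sym eq) (m<m*n m p {{>-nonZero 0<m}} (prime≥2 pp))

prime-induction : ∀ {ℓ} (P : ℕ → Set ℓ) → P 1 →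
  (∀ p n → Prime p → 0 < n → P n → P (p * n)) → ∀ n → 0 < n → P n
prime-induction P P1 Pp = <-rec (λ n → 0 < n → P n) step
  where
  step : ∀ n → (∀ {m} → m < n → 0 < m → P m) → 0 < n → P n
  step (suc zero) rec _ = P1
  step n@(suc (suc _)) rec _ with minFactor-prime n (s≤s (s≤s z≤n))
  ... | pp , p∣n with cofactor (s≤s (s≤s z≤n)) pp p∣n
  ... | m , eq , 0<m , m<n = subst P (sym eq) (Pp _ m pp 0<m (rec m<n 0<m))

-- The clauses of `kronAux` inspect a before n, so nothing reduces until a is split into the shapes
-- that they distinguish.
kronAux-1 : ∀ f a → kronAux f a 1 ≡ + 1
kronAux-1 f (+ 0)             = refl
kronAux-1 f (+ 1)             = refl
kronAux-1 f (+ suc (suc _))   = refl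
kronAux-1 f -[1+ 0 ]          = refl
kronAux-1 f -[1+ suc _ ]      = refl

kronAux-step : ∀ f a m → let n = suc (suc m) ; p = minFactor n in
  kronAux (suc f) a n ≡ kronPrime p a *ℤ kronAux f a (n / suc (p ∸ 1))
kronAux-step f (+ 0)           m = refl
kronAux-step f (+ 1)           m = refl
kronAux-step f (+ suc (suc _)) m = refl
kronAux-step f -[1+ 0 ]        m = refl
kronAux-step f -[1+ suc _ ]    m = refl

kronAux-cofactor : ∀ f a n m → 2 ≤ n → n ≡ minFactor n * m →
  kronAux (suc f) a n ≡ kronPrime (minFactor n) a *ℤ kronAux f a m
kronAux-cofactor f a n@(suc (suc k)) m 2≤n eq = trans (kronAux-step f a k)
  (cong (λ q → kronPrime (minFactor n) a *ℤ kronAux f a q) n/p≡m)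
  where
  p = minFactor n
  -- `kronAux` divides by `suc (p ∸ 1)` to have a visibly nonzero divisor; for a prime this is p
  -- itself.
  1+[p∸1]≡p : suc (p ∸ 1) ≡ p
  1+[p∸1]≡p = m+[n∸m]≡n {1} {p} (prime>0 (proj₁ (minFactor-prime n 2≤n)))
  n/p≡m : n / suc (p ∸ 1) ≡ m
  n/p≡m = trans (cong (_/ suc (p ∸ 1)) (trans eq (trans (*-comm p m) (cong (m *_) (sym 1+[p∸1]≡p)))))
                (m*n/n≡m m (suc (p ∸ 1)))
kronAux-cofactor f a 1 m (s≤s ()) eq

kronAux-fuel : ∀ f g a n → 0 < n → n ≤ f → n ≤ g → kronAux f a n ≡ kronAux g a n
kronAux-fuel f g a (suc zero) _ n≤f n≤g = trans (kronAux-1 f a) (sym (kronAux-1 g a))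
kronAux-fuel (suc f) (suc g) a n@(suc (suc k)) _ n≤f n≤g
  with minFactor-prime n (s≤s (s≤s z≤n))
... | pp , p∣n with cofactor (s≤s (s≤s z≤n)) pp p∣n
... | m , eq , 0<m , m<n =
  trans (kronAux-cofactor f a n m (s≤s (s≤s z≤n)) eq)
    (trans (cong (kronPrime (minFactor n) a *ℤ_) (kronAux-fuel f g a m 0<m (≤-pred (≤-trans m<n n≤f)) (≤-pred (≤-trans m<n n≤g))))
      (sym (kronAux-cofactor g a n m (s≤s (s≤s z≤n)) eq)))

kronecker-1 : ∀ a → kronecker a 1 ≡ + 1
kronecker-1 a = kronAux-1 1 a

kronecker-minFactor : ∀ a n m → 2 ≤ n → n ≡ minFactor n * m →
  kronecker a n ≡ kronPrime (minFactor n) a *ℤ kronecker a m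
kronecker-minFactor a n@(suc (suc k)) m 2≤n eq with minFactor-prime n 2≤n
... | pp , p∣n with cofactor 2≤n pp p∣n
... | m′ , eq′ , 0<m , m<n
  rewrite *-cancelˡ-≡ m m′ (minFactor n) {{prime⇒nonZero pp}} (trans (sym eq) eq′) =
  trans (kronAux-cofactor _ a n m′ 2≤n eq′)
    (cong (kronPrime (minFactor n) a *ℤ_) (kronAux-fuel _ m′ a m′ 0<m (≤-pred m<n) ≤-refl))
kronecker-minFactor a 1 m (s≤s ()) eq

*ℤ-swap : ∀ i j k → i *ℤ (j *ℤ k) ≡ j *ℤ (i *ℤ k)
*ℤ-swap i j k = trans (sym (ℤₚ.*-assoc i j k)) (trans (cong (_*ℤ k) (ℤₚ.*-comm i j)) (ℤₚ.*-assoc j i k))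

prime-∣-prime : ∀ {p q} → Prime p → Prime q → p ∣ q → p ≡ q
prime-∣-prime pp pq p∣q with prime⇒irreducible pq p∣q
... | inj₁ refl = contradiction (prime≥2 pp) λ { (s≤s ()) }
... | inj₂ eq   = eq

-- The recursion splits off only the least prime q of p n. If q ≠ p, then q divides n, and the
-- hypothesis at n / q, used for p and for q, exchanges the two primes.
kronecker-prime-* : ∀ a p n → Prime p → 0 < n → kronecker a (p * n) ≡ kronPrime p a *ℤ kronecker a n
kronecker-prime-* a p n pp 0<n = <-rec C step n p pp 0<n
  where
  C : ℕ → Set
  C n = ∀ p → Prime p → 0 < n → kronecker a (p * n) ≡ kronPrime p a *ℤ kronecker a n
  step : ∀ n → (∀ {m} → m < n → C m) → C n
  step n rec p pp 0<n = case-q (minFactor-prime (p * n) 2≤pn)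
    where
    2≤pn : 2 ≤ p * n
    2≤pn = ≤-trans (prime≥2 pp) (m≤m*n p n {{>-nonZero 0<n}})
    q = minFactor (p * n)
    case-q : Prime q × q ∣ p * n → kronecker a (p * n) ≡ kronPrime p a *ℤ kronecker a n
    case-q (pq , q∣pn) with q ≟ p
    ... | yes q≡p = subst (λ r → kronecker a (p * n) ≡ kronPrime r a *ℤ kronecker a n) q≡p
                      (kronecker-minFactor a (p * n) n 2≤pn (cong (_* n) (sym q≡p)))
    ... | no q≢p with euclidsLemma p n pq q∣pn
    ...   | inj₁ q∣p = contradiction (prime-∣-prime pq pp q∣p) q≢p
    ...   | inj₂ q∣n with cofactor (≤-trans (prime≥2 pq) (∣⇒≤ {{>-nonZero 0<n}} q∣n)) pq q∣n
    ...     | m , n≡qm , 0<m , m<n = begin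
      kronecker a (p * n)                                ≡⟨ kronecker-minFactor a (p * n) (p * m) 2≤pn pn≡qpm ⟩
      kronPrime q a *ℤ kronecker a (p * m)               ≡⟨ cong (kronPrime q a *ℤ_) (rec m<n p pp 0<m) ⟩
      kronPrime q a *ℤ (kronPrime p a *ℤ kronecker a m)  ≡⟨ *ℤ-swap (kronPrime q a) (kronPrime p a) _ ⟩
      kronPrime p a *ℤ (kronPrime q a *ℤ kronecker a m)  ≡⟨ cong (kronPrime p a *ℤ_) (rec m<n q pq 0<m) ⟨
      kronPrime p a *ℤ kronecker a (q * m)               ≡⟨ cong (λ z → kronPrime p a *ℤ kronecker a z) n≡qm ⟨
      kronPrime p a *ℤ kronecker a n ∎
      where
      open ≡-Reasoning
      pn≡qpm : p * n ≡ q * (p * m)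
      pn≡qpm = trans (cong (p *_) n≡qm) (trans (sym (*-assoc p q m)) (trans (cong (_* m) (*-comm p q)) (*-assoc q p m)))

kronecker-*ʳ : ∀ a m n → 0 < m → 0 < n → kronecker a (m * n) ≡ kronecker a m *ℤ kronecker a n
kronecker-*ʳ a m n 0<m 0<n = prime-induction P base step m 0<m
  where
  open ≡-Reasoning
  P : ℕ → Set
  P m = kronecker a (m * n) ≡ kronecker a m *ℤ kronecker a n
  base : P 1
  base = trans (cong (kronecker a) (*-identityˡ n))
    (sym (trans (cong (_*ℤ kronecker a n) (kronecker-1 a)) (ℤₚ.*-identityˡ _)))
  step : ∀ p m → Prime p → 0 < m → P m → P (p * m)
  step p m pp 0<m ih = begin
    kronecker a (p * m * n)                               ≡⟨ cong (kronecker a) (*-assoc p m n) ⟩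
    kronecker a (p * (m * n))                             ≡⟨ kronecker-prime-* a p (m * n) pp (*-mono-< 0<m 0<n) ⟩
    kronPrime p a *ℤ kronecker a (m * n)                  ≡⟨ cong (kronPrime p a *ℤ_) ih ⟩
    kronPrime p a *ℤ (kronecker a m *ℤ kronecker a n)     ≡⟨ ℤₚ.*-assoc (kronPrime p a) _ _ ⟨
    (kronPrime p a *ℤ kronecker a m) *ℤ kronecker a n     ≡⟨ cong (_*ℤ kronecker a n) (kronecker-prime-* a p m pp 0<m) ⟨
    kronecker a (p * m) *ℤ kronecker a n ∎

-- Congruences, the Legendre symbol and roots of polynomials modulo a prime

infix 4 _≋_[_]

record _≋_[_] (a b : ℤ) (n : ℕ) : Set where
  constructor mod-∣
  field ∣-diff : + n ∣ℤ a -ℤ b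

module _ {n : ℕ} where
  ≋-reflexive : ∀ {a b} → a ≡ b → a ≋ b [ n ]
  ≋-reflexive {a} refl = mod-∣ (dividesℤ (+ 0) (ℤₚ.+-inverseʳ a))

  ≋-refl : ∀ {a} → a ≋ a [ n ]
  ≋-refl = ≋-reflexive refl

  ≋-sym : ∀ {a b} → a ≋ b [ n ] → b ≋ a [ n ]
  ≋-sym {a} {b} (mod-∣ d) = mod-∣ (subst (+ n ∣ℤ_) (eq a b) (∣ℤ-neg d))
    where
    eq : ∀ a b → - (a -ℤ b) ≡ b -ℤ a
    eq = solveℤ-∀

  ≋-trans : ∀ {a b c} → a ≋ b [ n ] → b ≋ c [ n ] → a ≋ c [ n ]
  ≋-trans {a} {b} {c} (mod-∣ d) (mod-∣ e) = mod-∣ (subst (+ n ∣ℤ_) (eq a b c) (∣ℤ-+ d e))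
    where
    eq : ∀ a b c → (a -ℤ b) +ℤ (b -ℤ c) ≡ a -ℤ c
    eq = solveℤ-∀

  ≋-* : ∀ {a b c d} → a ≋ b [ n ] → c ≋ d [ n ] → a *ℤ c ≋ b *ℤ d [ n ]
  ≋-* {a} {b} {c} {d} (mod-∣ e) (mod-∣ f) =
    mod-∣ (subst (+ n ∣ℤ_) (eq a b c d) (∣ℤ-+ (∣ℤ-*ʳ c e) (∣ℤ-*ˡ b f)))
    where
    eq : ∀ a b c d → (a -ℤ b) *ℤ c +ℤ b *ℤ (c -ℤ d) ≡ a *ℤ c -ℤ b *ℤ d
    eq = solveℤ-∀

  ≋-^ : ∀ {a b} k → a ≋ b [ n ] → a ^ℤ k ≋ b ^ℤ k [ n ]
  ≋-^ zero    e = ≋-refl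
  ≋-^ (suc k) e = ≋-* e (≋-^ k e)

  ≋0⇒∣ : ∀ {a} → a ≋ + 0 [ n ] → + n ∣ℤ a
  ≋0⇒∣ {a} (mod-∣ d) = subst (+ n ∣ℤ_) (ℤₚ.+-identityʳ a) d

  ∣⇒≋0 : ∀ {a} → + n ∣ℤ a → a ≋ + 0 [ n ]
  ∣⇒≋0 {a} d = mod-∣ (subst (+ n ∣ℤ_) (sym (ℤₚ.+-identityʳ a)) d)

  ≋-∣ : ∀ {a b} → a ≋ b [ n ] → + n ∣ℤ b → + n ∣ℤ a
  ≋-∣ e d = ≋0⇒∣ (≋-trans e (∣⇒≋0 d))

  ≋-%ℕ : ∀ a .{{_ : NonZero n}} → a ≋ + (a %ℕ n) [ n ]
  ≋-%ℕ a = mod-∣ (dividesℤ (a /ℕ n)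
    (trans (cong (_-ℤ + (a %ℕ n)) (a≡a%ℕn+[a/ℕn]*n a n)) (eq (+ (a %ℕ n)) ((a /ℕ n) *ℤ + n))))
    where
    eq : ∀ r s → (r +ℤ s) -ℤ r ≡ s
    eq = solveℤ-∀

∣ℤ⇒∣ : ∀ {m n} → + m ∣ℤ + n → m ∣ n
∣ℤ⇒∣ = ∣⇒∣ᵤ

∣⇒∣ℤ : ∀ {m n} → m ∣ n → + m ∣ℤ + n
∣⇒∣ℤ = ∣ᵤ⇒∣

∣∧<⇒≡0 : ∀ {m n} → m ∣ n → n < m → n ≡ 0
∣∧<⇒≡0 {n = zero}  _   _   = refl
∣∧<⇒≡0 {n = suc n} m∣n n<m = contradiction (∣⇒≤ m∣n) (<⇒≱ n<m)

≋⇒≡ : ∀ {n i j} → + i ≋ + j [ n ] → i < n → j < n → i ≡ j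
≋⇒≡ {n} {i} {j} (mod-∣ d) i<n j<n = ℤₚ.+-injective (ℤₚ.i-j≡0⇒i≡j (+ i) (+ j)
  (ℤₚ.∣i∣≡0⇒i≡0 (∣∧<⇒≡0 (∣⇒∣ᵤ d) (≤-<-trans bound (⊔-pres-<m i<n j<n)))))
  where
  bound : ∣ + i -ℤ + j ∣ ≤ i ⊔ j
  bound = subst (λ z → ∣ z ∣ ≤ i ⊔ j) (sym (ℤₚ.m-n≡m⊖n i j)) (ℤₚ.∣m⊝n∣≤m⊔n i j)

%ℕ-unique : ∀ {n a r} .{{_ : NonZero n}} → a ≋ + r [ n ] → r < n → a %ℕ n ≡ r
%ℕ-unique {n} {a} e r<n = ≋⇒≡ (≋-trans (≋-sym (≋-%ℕ a)) e) (n%ℕd<d a n) r<n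

euclidℤ : ∀ {p} → Prime p → ∀ a b → + p ∣ℤ a *ℤ b → + p ∣ℤ a ⊎ + p ∣ℤ b
euclidℤ pp a b d with euclidsLemma ∣ a ∣ ∣ b ∣ pp (subst (_ ∣_) (ℤₚ.abs-* a b) (∣⇒∣ᵤ d))
... | inj₁ e = inj₁ (∣ᵤ⇒∣ e)
... | inj₂ e = inj₂ (∣ᵤ⇒∣ e)

data Trit : ℤ → Set where
  trit-0 : Trit (+ 0)
  trit-+ : Trit (+ 1)
  trit-- : Trit -[1+ 0 ]

-- Distinct values among 0, 1, -1 differ by 1 or 2 in absolute value, which no p ≥ 3 divides. This
-- turns congruences between symbols into equalities.
trit-≋⇒≡ : ∀ {p a b} → 3 ≤ p → Trit a → Trit b → a ≋ b [ p ] → a ≡ b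
trit-≋⇒≡ {p} 3≤p ta tb (mod-∣ d) = go ta tb (∣⇒∣ᵤ d)
  where
  no1 : ¬ p ∣ 1
  no1 e = contradiction (≤-trans 3≤p (∣⇒≤ e)) λ { (s≤s ()) }
  no2 : ¬ p ∣ 2
  no2 e = contradiction (≤-trans 3≤p (∣⇒≤ e)) λ { (s≤s (s≤s ())) }
  go : ∀ {a b} → Trit a → Trit b → p ∣ ∣ a -ℤ b ∣ → a ≡ b
  go trit-0 trit-0 e = refl
  go trit-0 trit-+ e = contradiction e no1
  go trit-0 trit-- e = contradiction e no1
  go trit-+ trit-0 e = contradiction e no1
  go trit-+ trit-+ e = refl
  go trit-+ trit-- e = contradiction e no2
  go trit-- trit-0 e = contradiction e no1
  go trit-- trit-+ e = contradiction e no2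
  go trit-- trit-- e = refl

trit-* : ∀ {a b} → Trit a → Trit b → Trit (a *ℤ b)
trit-* trit-0 _      = trit-0
trit-* trit-+ trit-0 = trit-0
trit-* trit-+ trit-+ = trit-+
trit-* trit-+ trit-- = trit--
trit-* trit-- trit-0 = trit-0
trit-* trit-- trit-+ = trit--
trit-* trit-- trit-- = trit-+

-- The meaning of the Boolean search in `legendre`, indexed by the value so that matching on it also
-- fixes the symbol.
data Legendre (p : ℕ) (a : ℤ) : ℤ → Set where
  divisible  : + p ∣ℤ a → Legendre p a (+ 0)
  residue    : ¬ + p ∣ℤ a → ∀ (x : ℕ) → + (x * x) ≋ a [ p ] → Legendre p a (+ 1)
  nonresidue : ¬ + p ∣ℤ a → (∀ (x : ℕ) → ¬ + (x * x) ≋ a [ p ]) → Legendre p a -[1+ 0 ]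

legendre-spec : ∀ p → 0 < p → ∀ a → Legendre p a (legendre p a)
legendre-spec p@(suc q) _ a with (a %ℕ p) ≡ᵇ 0 in eq
... | true  = divisible (≋0⇒∣ (≋-trans (≋-%ℕ a) (≋-reflexive (cong +_ (≡ᵇ-true eq)))))
... | false with isSquareMod p (a %ℕ p) in sq
...   | true  = let x , _ , e = find (any⁻ _ (upTo p) (subst T (sym sq) _)) in
  residue ndiv x (≋-trans (≋-%ℕ (+ (x * x)))
    (≋-trans (≋-reflexive (cong +_ (≡ᵇ⇒≡ _ (a %ℕ p) e))) (≋-sym (≋-%ℕ a))))
  where ndiv : ¬ + p ∣ℤ a
        ndiv d = ≡ᵇ-false eq (%ℕ-unique (∣⇒≋0 d) (s≤s z≤n))
-- `isSquareMod` tries only x < p, so an arbitrary square root x is first reduced modulo p.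
...   | false = nonresidue ndiv λ x e → let y = x % p in
    subst T sq (any⁺ _ (lose (∈-upTo⁺ (m%n<n x p)) (≡⇒≡ᵇ ((y * y) % p) (a %ℕ p)
      (%ℕ-unique {a = + (y * y)} (≋-trans (square-≋ y x (≋-sym (≋-%ℕ (+ x)))) (≋-trans e (≋-%ℕ a))) (n%ℕd<d a p)))))
  where ndiv : ¬ + p ∣ℤ a
        ndiv d = ≡ᵇ-false eq (%ℕ-unique (∣⇒≋0 d) (s≤s z≤n))
        square-≋ : ∀ y x → + y ≋ + x [ p ] → + (y * y) ≋ + (x * x) [ p ]
        square-≋ y x e = subst₂ (_≋_[ p ]) (sym (ℤₚ.pos-* y y)) (sym (ℤₚ.pos-* x x)) (≋-* e e)

legendre-trit : ∀ p → 0 < p → ∀ a → Trit (legendre p a)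
legendre-trit p 0<p a with legendre p a | legendre-spec p 0<p a
... | _ | divisible _    = trit-0
... | _ | residue _ _ _  = trit-+
... | _ | nonresidue _ _ = trit--

-- The list cs stands for the monic polynomial of degree length cs
-- whose lower coefficients are cs, constant term first.
evalMonic : List ℤ → ℤ → ℤ
evalMonic []       x = + 1
evalMonic (c ∷ cs) x = c +ℤ x *ℤ evalMonic cs x

-- Synthetic division by X - r: the coefficients of the quotient are the Horner values at r of the
-- successive tails, and its leading 1 stays implicit.
quotientAt : ℤ → List ℤ → List ℤ
quotientAt r []                  = []
quotientAt r (c ∷ [])            = []
quotientAt r (c ∷ cs@(_ ∷ _))    = evalMonic cs r ∷ quotientAt r cs

length-quotientAt : ∀ r c cs → length (quotientAt r (c ∷ cs)) ≡ length cs
length-quotientAt r c []       = refl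
length-quotientAt r c (d ∷ cs) = cong suc (length-quotientAt r d cs)

evalMonic-quotientAt : ∀ r c cs x → evalMonic (c ∷ cs) x -ℤ evalMonic (c ∷ cs) r ≡
  (x -ℤ r) *ℤ evalMonic (quotientAt r (c ∷ cs)) x
evalMonic-quotientAt r c [] x = eq c x r
  where eq : ∀ c x r → (c +ℤ x *ℤ + 1) -ℤ (c +ℤ r *ℤ + 1) ≡ (x -ℤ r) *ℤ + 1
        eq = solveℤ-∀
evalMonic-quotientAt r c cs@(d ∷ ds) x = begin
  (c +ℤ x *ℤ E) -ℤ (c +ℤ r *ℤ F)             ≡⟨ eq₁ c x r E F ⟩
  x *ℤ (E -ℤ F) +ℤ (x -ℤ r) *ℤ F             ≡⟨ cong (λ z → x *ℤ z +ℤ (x -ℤ r) *ℤ F) (evalMonic-quotientAt r d ds x) ⟩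
  x *ℤ ((x -ℤ r) *ℤ Q) +ℤ (x -ℤ r) *ℤ F      ≡⟨ eq₂ x r Q F ⟩
  (x -ℤ r) *ℤ (F +ℤ x *ℤ Q) ∎
  where
  open ≡-Reasoning
  E = evalMonic cs x
  F = evalMonic cs r
  Q = evalMonic (quotientAt r cs) x
  eq₁ : ∀ c x r E F → (c +ℤ x *ℤ E) -ℤ (c +ℤ r *ℤ F) ≡ x *ℤ (E -ℤ F) +ℤ (x -ℤ r) *ℤ F
  eq₁ = solveℤ-∀
  eq₂ : ∀ x r Q F → x *ℤ ((x -ℤ r) *ℤ Q) +ℤ (x -ℤ r) *ℤ F ≡ (x -ℤ r) *ℤ (F +ℤ x *ℤ Q)
  eq₂ = solveℤ-∀

module _ {p : ℕ} (pp : Prime p) where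

  -- At a further root x the product of x - r and the quotient vanishes modulo p while x - r does
  -- not, so x is a root of the quotient, of degree one less. In degree 0 the polynomial is 1.
  lagrange : ∀ cs rs → length rs ≡ suc (length cs) →
    AllPairs (λ r s → ¬ r ≋ s [ p ]) rs → ¬ All (λ r → + p ∣ℤ evalMonic cs r) rs
  lagrange [] (r ∷ rs) len _ (d ∷ _) =
    contradiction (∣1⇒≡1 (∣ℤ⇒∣ d)) (>⇒≢ (prime≥2 pp))
  lagrange (c ∷ cs) (r ∷ rs) len (r≢ ∷ distinct) (fr ∷ froots) =
    lagrange (quotientAt r (c ∷ cs)) rs
      (trans (suc-injective len) (cong suc (sym (length-quotientAt r c cs)))) distinct
      (All.zipWith roots (r≢ , froots))
    where
    roots : ∀ {x} → (¬ r ≋ x [ p ]) × (+ p ∣ℤ evalMonic (c ∷ cs) x) → + p ∣ℤ evalMonic (quotientAt r (c ∷ cs)) x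
    roots {x} (r≢x , fx) with euclidℤ pp (x -ℤ r) _
      (subst (+ p ∣ℤ_) (evalMonic-quotientAt r c cs x) (∣ℤ-+ fx (∣ℤ-neg fr)))
    ... | inj₁ x≡r = contradiction (≋-sym (mod-∣ x≡r)) r≢x
    ... | inj₂ d   = d

evalMonic-replicate : ∀ k x → evalMonic (replicate k (+ 0)) x ≡ x ^ℤ k
evalMonic-replicate zero    x = refl
evalMonic-replicate (suc k) x = trans (ℤₚ.+-identityˡ _) (cong (x *ℤ_) (evalMonic-replicate k x))

-- Gauss's lemma and Euler's criterion

∑ ∏ : ℕ → (ℕ → ℕ) → ℕ
∑ n f = sum (applyUpTo f n)
∏ n f = product (applyUpTo f n)

sgn : ℕ → ℤ
sgn n = -[1+ 0 ] ^ℤ n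

sgn-+ : ∀ m n → sgn (m + n) ≡ sgn m *ℤ sgn n
sgn-+ = ℤₚ.^-distribˡ-+-* -[1+ 0 ]

sgn-±1 : ∀ n → sgn n ≡ + 1 ⊎ sgn n ≡ -[1+ 0 ]
sgn-±1 zero = inj₁ refl
sgn-±1 (suc n) with sgn n | sgn-±1 n
... | _ | inj₁ refl = inj₂ refl
... | _ | inj₂ refl = inj₁ refl

sgn-square : ∀ n → sgn n *ℤ sgn n ≡ + 1
sgn-square n with sgn n | sgn-±1 n
... | _ | inj₁ refl = refl
... | _ | inj₂ refl = refl

sgn-trit : ∀ n → Trit (sgn n)
sgn-trit n with sgn n | sgn-±1 n
... | _ | inj₁ refl = trit-+
... | _ | inj₂ refl = trit--

sgn-double : ∀ n → sgn (n + n) ≡ + 1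
sgn-double n = trans (sgn-+ n n) (sgn-square n)

^ℤ-*-distrib : ∀ a b n → (a *ℤ b) ^ℤ n ≡ a ^ℤ n *ℤ b ^ℤ n
^ℤ-*-distrib a b zero    = refl
^ℤ-*-distrib a b (suc n) = trans (cong (a *ℤ b *ℤ_) (^ℤ-*-distrib a b n)) (eq a b (a ^ℤ n) (b ^ℤ n))
  where eq : ∀ a b c d → (a *ℤ b) *ℤ (c *ℤ d) ≡ (a *ℤ c) *ℤ (b *ℤ d)
        eq = solveℤ-∀

0^n≡0 : ∀ {n} → 0 < n → (+ 0) ^ℤ n ≡ + 0
0^n≡0 (s≤s _) = refl

Unique⊆⇒↭ : ∀ {xs ys : List ℕ} → Unique xs → xs ⊆ ys → length ys ≡ length xs → xs ↭ ys
Unique⊆⇒↭ {[]}     {[]} _ _ _ = ↭-refl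
Unique⊆⇒↭ {x ∷ xs} {ys} (x∉ ∷ u) sub len with ∈-∃++ (sub (here refl))
... | as , bs , refl = ↭-trans (prep x (Unique⊆⇒↭ u sub′ len′)) (↭-sym (shift x as bs))
  where
  len′ : length (as ++ bs) ≡ length xs
  len′ = suc-injective (trans (sym (↭-length (shift x as bs))) len)
  sub′ : xs ⊆ as ++ bs
  sub′ {z} z∈xs with ∈-++⁻ as (sub (there z∈xs))
  ... | inj₁ z∈as         = ∈-++⁺ˡ z∈as
  ... | inj₂ (there z∈bs) = ∈-++⁺ʳ as z∈bs
  ... | inj₂ (here refl)  = contradiction refl (All.lookup x∉ z∈xs)

-- `∏ n suc` is n!. In Gauss's lemma t lists the absolutely least residues, a rearrangement of 1,
-- ..., n.
∏-permute : ∀ n (t : ℕ → ℕ) → (∀ i → i < n → 0 < t i × t i ≤ n) →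
  (∀ i j → i < n → j < n → t i ≡ t j → i ≡ j) → ∏ n t ≡ ∏ n suc
∏-permute n t range inj = product-↭ (Unique⊆⇒↭
  (Uniqueₚ.applyUpTo⁺₁ t n λ i<j j<n eq → <⇒≢ i<j (inj _ _ (<-trans i<j j<n) j<n eq))
  sub (trans (length-applyUpTo suc n) (sym (length-applyUpTo t n))))
  where
  sub : applyUpTo t n ⊆ applyUpTo suc n
  sub z∈ with ∈-applyUpTo⁻ t z∈
  ... | i , i<n , refl with t i | range i i<n
  ...   | suc k | _ , k<n = ∈-applyUpTo⁺ suc k<n

∏-≋ : ∀ {p} a n (f e t : ℕ → ℕ) → (∀ i → i < n → a *ℤ + f i ≋ sgn (e i) *ℤ + t i [ p ]) →
  a ^ℤ n *ℤ + ∏ n f ≋ sgn (∑ n e) *ℤ + ∏ n t [ p ]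
∏-≋ a zero f e t h = ≋-refl
∏-≋ {p} a (suc n) f e t h = subst₂ (_≋_[ p ]) (eqˡ) eqʳ
  (≋-* (h 0 (s≤s z≤n)) (∏-≋ a n (f ∘ suc) (e ∘ suc) (t ∘ suc) (λ i i<n → h (suc i) (s≤s i<n))))
  where
  eq : ∀ a b c d → (a *ℤ b) *ℤ (c *ℤ d) ≡ (a *ℤ c) *ℤ (b *ℤ d)
  eq = solveℤ-∀
  F = ∏ n (f ∘ suc)
  G = ∏ n (t ∘ suc)
  S = ∑ n (e ∘ suc)
  eqˡ : (a *ℤ + f 0) *ℤ (a ^ℤ n *ℤ + F) ≡ (a *ℤ a ^ℤ n) *ℤ + (f 0 * F)
  eqˡ = trans (eq a (+ f 0) (a ^ℤ n) (+ F)) (cong (a *ℤ a ^ℤ n *ℤ_) (sym (ℤₚ.pos-* (f 0) F)))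
  eqʳ : (sgn (e 0) *ℤ + t 0) *ℤ (sgn S *ℤ + G) ≡ sgn (e 0 + S) *ℤ + (t 0 * G)
  eqʳ = trans (eq (sgn (e 0)) (+ t 0) (sgn S) (+ G)) (cong₂ _*ℤ_ (sym (sgn-+ (e 0) S)) (sym (ℤₚ.pos-* (t 0) G)))

prime-∤-∏ : ∀ {p} → Prime p → ∀ n f → (∀ i → i < n → p ∤ f i) → p ∤ ∏ n f
prime-∤-∏ pp zero f h d = contradiction (∣1⇒≡1 d) (>⇒≢ (prime≥2 pp))
prime-∤-∏ pp (suc n) f h d with euclidsLemma (f 0) _ pp d
... | inj₁ e = h 0 (s≤s z≤n) e
... | inj₂ e = prime-∤-∏ pp n (f ∘ suc) (λ i i<n → h (suc i) (s≤s i<n)) e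

ι : Bool → ℕ
ι b = if b then 1 else 0

<ᵇ-true : ∀ {m n} → m < n → (m <ᵇ n) ≡ true
<ᵇ-true {m} {n} m<n with m <ᵇ n in eq
... | true  = refl
... | false = contradiction (<⇒<ᵇ m<n) (subst T eq)

<ᵇ-false : ∀ {m n} → n ≤ m → (m <ᵇ n) ≡ false
<ᵇ-false {m} {n} n≤m with m <ᵇ n in eq
... | false = refl
... | true  = contradiction (<ᵇ⇒< m n (subst T (sym eq) _)) (≤⇒≯ n≤m)

ι-≮ : ∀ {m n} → n ≤ m → ι (m <ᵇ n) ≡ 0
ι-≮ n≤m = cong ι (<ᵇ-false n≤m)

-- The absolutely least residue of r < 2P + 1 is ± leastAbs P r,
-- with a minus sign exactly when P < r.
leastAbs : ℕ → ℕ → ℕ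
leastAbs P r = if P <ᵇ r then suc (2 * P) ∸ r else r

module _ (P r : ℕ) (r<p : r < suc (2 * P)) where
  leastAbs-≋ : + r ≋ sgn (ι (P <ᵇ r)) *ℤ + leastAbs P r [ suc (2 * P) ]
  leastAbs-≋ with P <ᵇ r
  ... | false = ≋-reflexive (sym (ℤₚ.*-identityˡ (+ r)))
  ... | true  = mod-∣ (dividesℤ (+ 1) (begin
    + r -ℤ (-[1+ 0 ] *ℤ + s)   ≡⟨ eq (+ r) (+ s) ⟩
    + r +ℤ + s                 ≡⟨ ℤₚ.pos-+ r s ⟨
    + (r + s)                  ≡⟨ cong +_ (m+[n∸m]≡n (<⇒≤ r<p)) ⟩
    + suc (2 * P)              ≡⟨ ℤₚ.*-identityˡ _ ⟨
    + 1 *ℤ + suc (2 * P) ∎))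
    where
    open ≡-Reasoning
    s = suc (2 * P) ∸ r
    eq : ∀ r s → r -ℤ (-[1+ 0 ] *ℤ s) ≡ r +ℤ s
    eq = solveℤ-∀

  leastAbs-range : 0 < r → 0 < leastAbs P r × leastAbs P r ≤ P
  leastAbs-range 0<r with P <ᵇ r in eq
  ... | false = 0<r , ≮⇒≥ (λ P<r → subst T eq (<⇒<ᵇ P<r))
  ... | true  = m<n⇒0<n∸m r<p , (begin
    suc (2 * P) ∸ r       ≤⟨ ∸-monoʳ-≤ (suc (2 * P)) (<ᵇ⇒< P r (subst T (sym eq) _)) ⟩
    suc (2 * P) ∸ suc P   ≡⟨ m+n∸m≡n P (P + 0) ⟩
    P + 0                 ≡⟨ +-identityʳ P ⟩
    P ∎)
    where open ≤-Reasoning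

module _ {p : ℕ} (pp : Prime p) where
  ≋-cancelˡ : ∀ c x y → ¬ + p ∣ℤ c → c *ℤ x ≋ c *ℤ y [ p ] → x ≋ y [ p ]
  ≋-cancelˡ c x y p∤c (mod-∣ d) =
    [ (λ e → contradiction e p∤c) , mod-∣ ]′ (euclidℤ pp c (x -ℤ y) (subst (+ p ∣ℤ_) (eq c x y) d))
    where
    eq : ∀ c x y → c *ℤ x -ℤ c *ℤ y ≡ c *ℤ (x -ℤ y)
    eq = solveℤ-∀

  ≋-square-roots : ∀ x y → x *ℤ x ≋ y *ℤ y [ p ] → x ≋ y [ p ] ⊎ + p ∣ℤ x +ℤ y
  ≋-square-roots x y (mod-∣ d) =
    [ inj₁ ∘ mod-∣ , inj₂ ]′ (euclidℤ pp (x -ℤ y) (x +ℤ y) (subst (+ p ∣ℤ_) (eq x y) d))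
    where
    eq : ∀ x y → x *ℤ x -ℤ y *ℤ y ≡ (x -ℤ y) *ℤ (x +ℤ y)
    eq = solveℤ-∀

module OddPrime (P : ℕ) (pp : Prime (suc (2 * P))) where
  p : ℕ
  p = suc (2 * P)

  0<P : 0 < P
  0<P = n≢0⇒n>0 λ { refl → ¬prime[1] pp }

  3≤p : 3 ≤ p
  3≤p = s≤s (*-monoʳ-≤ 2 0<P)

  <P⇒<p : ∀ {i} → i < P → suc i < p
  <P⇒<p i<P = s≤s (≤-trans i<P (m≤m+n P (P + 0)))

  -- A collision makes p divide the difference or the sum of i + 1 and j + 1, and the sum is at most
  -- 2P < p. This serves Gauss's lemma and also shows that the roots fed to `lagrange` are distinct.
  half-square-injective : ∀ i j → i < P → j < P →
    + suc i *ℤ + suc i ≋ + suc j *ℤ + suc j [ p ] → i ≡ j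
  half-square-injective i j i<P j<P e =
    [ (λ d → suc-injective (≋⇒≡ d (<P⇒<p i<P) (<P⇒<p j<P)))
    , (λ d → contradiction (∣∧<⇒≡0 (∣⇒∣ᵤ d) i+j<p) λ ())
    ]′ (≋-square-roots pp (+ suc i) (+ suc j) e)
    where
    i+j<p : suc i + suc j < p
    i+j<p = s≤s (+-mono-≤ i<P (≤-trans j<P (≤-reflexive (sym (+-identityʳ P)))))

  module _ (a : ℤ) (p∤a : ¬ + p ∣ℤ a) where
    residueAt signAt absAt : ℕ → ℕ
    residueAt i = (a *ℤ + suc i) %ℕ p
    signAt i = ι (P <ᵇ residueAt i)
    absAt i = leastAbs P (residueAt i)

    at-≋ : ∀ i → a *ℤ + suc i ≋ sgn (signAt i) *ℤ + absAt i [ p ]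
    at-≋ i = ≋-trans (≋-%ℕ (a *ℤ + suc i)) (leastAbs-≋ P (residueAt i) (n%ℕd<d (a *ℤ + suc i) p))

    residueAt>0 : ∀ i → i < P → 0 < residueAt i
    residueAt>0 i i<P = n≢0⇒n>0 λ r≡0 → case euclidℤ pp a (+ suc i) (≋-∣ (≋-%ℕ (a *ℤ + suc i)) (subst (λ r → + p ∣ℤ + r) (sym r≡0) (dividesℤ (+ 0) refl))) of λ
      { (inj₁ e) → p∤a e
      ; (inj₂ e) → contradiction (∣∧<⇒≡0 (∣ℤ⇒∣ e) (<P⇒<p i<P)) λ () }

    -- Squaring removes the unknown signs, so equal absolute residues give (i + 1)² ≡ (j + 1)² once
    -- a² is cancelled.
    absAt-injective : ∀ i j → i < P → j < P → absAt i ≡ absAt j → i ≡ j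
    absAt-injective i j i<P j<P eq = half-square-injective i j i<P j<P cancelled
      where
      sq : ∀ i → (a *ℤ a) *ℤ (+ suc i *ℤ + suc i) ≋ + absAt i *ℤ + absAt i [ p ]
      sq i = subst₂ (_≋_[ p ]) (eq₁ a (+ suc i)) eq₂ (≋-* (at-≋ i) (at-≋ i))
        where
        eq₁ : ∀ a x → (a *ℤ x) *ℤ (a *ℤ x) ≡ (a *ℤ a) *ℤ (x *ℤ x)
        eq₁ = solveℤ-∀
        s = sgn (signAt i)
        t = + absAt i
        eq₂ : (s *ℤ t) *ℤ (s *ℤ t) ≡ t *ℤ t
        eq₂ = trans (eq₁ s t) (trans (cong (_*ℤ (t *ℤ t)) (sgn-square (signAt i))) (ℤₚ.*-identityˡ _))
      same : (a *ℤ a) *ℤ (+ suc i *ℤ + suc i) ≋ (a *ℤ a) *ℤ (+ suc j *ℤ + suc j) [ p ]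
      same = ≋-trans (sq i) (≋-trans (≋-reflexive (cong (λ t → + t *ℤ + t) eq)) (≋-sym (sq j)))
      cancelled : + suc i *ℤ + suc i ≋ + suc j *ℤ + suc j [ p ]
      cancelled = ≋-cancelˡ pp (a *ℤ a) _ _ (λ d → [ p∤a , p∤a ]′ (euclidℤ pp a a d)) same

    -- The product of the congruences `at-≋` has a^P P! on one side and, the absolute residues being
    -- a permutation of 1, ..., P, a sign times P! on the other. P! is prime to p.
    gauss-lemma : a ^ℤ P ≋ sgn (∑ P signAt) [ p ]
    gauss-lemma = ≋-cancelˡ pp (+ ∏ P suc) _ _
      (λ d → prime-∤-∏ pp P suc (λ i i<P e → contradiction (∣∧<⇒≡0 e (<P⇒<p i<P)) λ ()) (∣ℤ⇒∣ d))
      (subst₂ (_≋_[ p ]) (ℤₚ.*-comm _ (+ ∏ P suc)) (ℤₚ.*-comm _ (+ ∏ P suc))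
        (subst (λ t → a ^ℤ P *ℤ + ∏ P suc ≋ sgn (∑ P signAt) *ℤ + t [ p ]) ∏absAt
          (∏-≋ a P suc signAt absAt (λ i _ → at-≋ i))))
      where
      ∏absAt : ∏ P absAt ≡ ∏ P suc
      ∏absAt = ∏-permute P absAt
        (λ i i<P → leastAbs-range P (residueAt i) (n%ℕd<d (a *ℤ + suc i) p) (residueAt>0 i i<P)) absAt-injective

  -- The squares of 1, ..., P are already P distinct roots of X^P - 1; a nonsquare root would be one
  -- more than the degree allows.
  roots-of-unity-are-squares : ∀ a → ¬ + p ∣ℤ a → a ^ℤ P ≋ + 1 [ p ] →
    ¬ (∀ (x : ℕ) → ¬ + (x * x) ≋ a [ p ])
  roots-of-unity-are-squares a p∤a a^P≋1 nonsq = go P refl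
    where
    sqs : ℕ → ℤ
    sqs i = + suc i *ℤ + suc i
    root : ∀ k → P ≡ suc k → ∀ x → x ^ℤ P ≋ + 1 [ p ] → + p ∣ℤ evalMonic (-[1+ 0 ] ∷ replicate k (+ 0)) x
    root k P≡ x (mod-∣ d) = subst (+ p ∣ℤ_) (trans (ℤₚ.+-comm (x ^ℤ P) -[1+ 0 ]) (cong (-[1+ 0 ] +ℤ_)
      (trans (cong (x ^ℤ_) P≡) (cong (x *ℤ_) (sym (evalMonic-replicate k x)))))) d
    -- Fermat's little theorem for i + 1: by Gauss's lemma its P-th power is ±1, and the square of
    -- that is 1.
    square-root : ∀ {i} → i < P → sqs i ^ℤ P ≋ + 1 [ p ]
    square-root {i} i<P = ≋-trans (≋-reflexive (^ℤ-*-distrib (+ suc i) (+ suc i) P))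
      (≋-trans (≋-* g g) (≋-reflexive (sgn-square (∑ P (signAt (+ suc i) p∤i)))))
      where
      p∤i : ¬ + p ∣ℤ + suc i
      p∤i e = contradiction (∣∧<⇒≡0 (∣ℤ⇒∣ e) (<P⇒<p i<P)) λ ()
      g = gauss-lemma (+ suc i) p∤i
    -- P is exposed as k + 1 since the coefficient list of X^P - 1 is -1 followed by k zeros.
    go : ∀ k → ¬ (P ≡ k)
    go zero P≡0 = contradiction (subst (0 <_) P≡0 0<P) λ ()
    go (suc k) P≡ = lagrange pp (-[1+ 0 ] ∷ replicate k (+ 0)) (a ∷ applyUpTo sqs P)
      (cong suc (trans (length-applyUpTo sqs P) (trans P≡ (cong suc (sym (length-replicate k))))))
      (Allₚ.applyUpTo⁺₂ sqs P (λ i e → nonsq (suc i) (≋-trans (≋-reflexive (ℤₚ.pos-* (suc i) (suc i))) (≋-sym e)))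
        ∷ AllPairsₚ.applyUpTo⁺₁ sqs P (λ {i} {j} i<j j<P e → <⇒≢ i<j (half-square-injective i j (<-trans i<j j<P) j<P e)))
      (root k P≡ a a^P≋1 ∷ Allₚ.applyUpTo⁺₁ sqs P (λ i<P → root k P≡ _ (square-root i<P)))

  0^P : (+ 0) ^ℤ P ≡ + 0
  0^P = 0^n≡0 0<P

  euler-criterion : ∀ a → legendre p a ≋ a ^ℤ P [ p ]
  euler-criterion a with legendre p a | legendre-spec p (s≤s z≤n) a
  ... | _ | divisible d = ≋-sym (≋-trans (≋-^ P (∣⇒≋0 d)) (≋-reflexive 0^P))
  ... | _ | residue p∤a x e = ≋-sym (≋-trans (≋-^ P (≋-sym e)) (≋-trans
      (≋-reflexive (trans (cong (_^ℤ P) (ℤₚ.pos-* x x)) (^ℤ-*-distrib (+ x) (+ x) P)))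
      (≋-trans (≋-* g g) (≋-reflexive (sgn-square (∑ P (signAt (+ x) p∤x)))))))
    where
    p∤x : ¬ + p ∣ℤ + x
    p∤x d = p∤a (≋-∣ (≋-sym e) (subst (+ p ∣ℤ_) (sym (ℤₚ.pos-* x x)) (∣ℤ-*ʳ (+ x) d)))
    g = gauss-lemma (+ x) p∤x
  ... | _ | nonresidue p∤a nonsq with sgn-±1 (∑ P (signAt a p∤a))
  ...   | inj₂ s≡-1 = ≋-sym (≋-trans (gauss-lemma a p∤a) (≋-reflexive s≡-1))
  ...   | inj₁ s≡1  = contradiction nonsq
    (roots-of-unity-are-squares a p∤a (≋-trans (gauss-lemma a p∤a) (≋-reflexive s≡1)))

  legendre-unique : ∀ {a t} → Trit t → a ^ℤ P ≋ t [ p ] → legendre p a ≡ t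
  legendre-unique {a} tt e = trit-≋⇒≡ 3≤p (legendre-trit p (s≤s z≤n) a) tt (≋-trans (euler-criterion a) e)

  legendre-* : ∀ a b → legendre p (a *ℤ b) ≡ legendre p a *ℤ legendre p b
  legendre-* a b = legendre-unique (trit-* (legendre-trit p (s≤s z≤n) a) (legendre-trit p (s≤s z≤n) b))
    (≋-trans (≋-reflexive (^ℤ-*-distrib a b P)) (≋-sym (≋-* (euler-criterion a) (euler-criterion b))))

  legendre-≋ : ∀ {a b} → a ≋ b [ p ] → legendre p a ≡ legendre p b
  legendre-≋ {a} {b} e = legendre-unique (legendre-trit p (s≤s z≤n) b) (≋-trans (≋-^ P e) (≋-sym (euler-criterion b)))

  legendre-gauss : ∀ a (p∤a : ¬ + p ∣ℤ a) → legendre p a ≡ sgn (∑ P (signAt a p∤a))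
  legendre-gauss a p∤a = legendre-unique (sgn-trit (∑ P (signAt a p∤a))) (gauss-lemma a p∤a)

  legendre--1 : legendre p -[1+ 0 ] ≡ sgn P
  legendre--1 = legendre-unique (sgn-trit P) ≋-refl

  legendre-divisible : ∀ {a} → + p ∣ℤ a → legendre p a ≡ + 0
  legendre-divisible d = legendre-unique trit-0 (≋-trans (≋-^ P (∣⇒≋0 d)) (≋-reflexive 0^P))

-- Quadratic reciprocity for primes

∑-cong : ∀ n {f g : ℕ → ℕ} → (∀ i → i < n → f i ≡ g i) → ∑ n f ≡ ∑ n g
∑-cong zero    h = refl
∑-cong (suc n) h = cong₂ _+_ (h 0 (s≤s z≤n)) (∑-cong n (λ i i<n → h (suc i) (s≤s i<n)))

∑-+ : ∀ n (f g : ℕ → ℕ) → ∑ n (λ i → f i + g i) ≡ ∑ n f + ∑ n g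
∑-+ zero    f g = refl
∑-+ (suc n) f g = trans (cong (_+_ (f 0 + g 0)) (∑-+ n (f ∘ suc) (g ∘ suc))) (eq (f 0) (g 0) _ _)
  where eq : ∀ a b c d → (a + b) + (c + d) ≡ (a + c) + (b + d)
        eq = solveℕ-∀

∑-const : ∀ n c → ∑ n (λ _ → c) ≡ n * c
∑-const zero    c = refl
∑-const (suc n) c = cong (_+_ c) (∑-const n c)

∑-swap : ∀ m n (f : ℕ → ℕ → ℕ) → ∑ m (λ i → ∑ n (λ j → f i j)) ≡ ∑ n (λ j → ∑ m (λ i → f i j))
∑-swap zero    n f = sym (trans (∑-const n 0) (*-zeroʳ n))
∑-swap (suc m) n f = trans (cong (_+_ (∑ n (f 0))) (∑-swap m n (f ∘ suc)))
  (sym (∑-+ n (f 0) (λ j → ∑ m (λ i → f (suc i) j))))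

∑-last : ∀ n (f : ℕ → ℕ) → ∑ (suc n) f ≡ ∑ n f + f n
∑-last zero    f = +-identityʳ (f 0)
∑-last (suc n) f = trans (cong (_+_ (f 0)) (∑-last n (f ∘ suc))) (sym (+-assoc (f 0) _ _))

∑-reverse : ∀ n (f : ℕ → ℕ) → ∑ n f ≡ ∑ n (λ i → f (n ∸ suc i))
∑-reverse zero    f = refl
∑-reverse (suc n) f = trans (∑-last n f) (trans (+-comm (∑ n f) (f n)) (cong (_+_ (f n)) (∑-reverse n f)))

∑-zero : ∀ n (f : ℕ → ℕ) → (∀ i → i < n → f i ≡ 0) → ∑ n f ≡ 0
∑-zero n f h = trans (∑-cong n h) (trans (∑-const n 0) (*-zeroʳ n))

∑-single : ∀ n (f : ℕ → ℕ) t → (∀ j → j ≢ t → f j ≡ 0) → t < n → ∑ n f ≡ f t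
∑-single (suc n) f zero    h _ = trans (cong (_+_ (f 0)) (∑-zero n (f ∘ suc) (λ i _ → h (suc i) λ ()))) (+-identityʳ (f 0))
∑-single (suc n) f (suc t) h (s≤s t<n) =
  trans (cong (_+ ∑ n (f ∘ suc)) (h 0 λ ())) (∑-single n (f ∘ suc) t (λ j j≢t → h (suc j) (j≢t ∘ suc-injective)) t<n)

-- With X = q (i + 1) and Y = p (j + 1), a lattice point (i , j) above the diagonal lies in the
-- strip X < Y ≤ X + P (`near`) or beyond it (`far`). The width P is the bound on an absolutely
-- least residue.
near far : ℕ → ℕ → ℕ → ℕ
near P X Y = ι ((X <ᵇ Y) ∧ (Y <ᵇ suc (X + P)))
far P X Y  = ι (X + P <ᵇ Y)

near-below : ∀ P {X Y} → Y ≤ X → near P X Y ≡ 0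
near-below P Y≤X rewrite <ᵇ-false Y≤X = refl

near-beyond : ∀ P {X Y} → X + P < Y → near P X Y ≡ 0
near-beyond P {X} {Y} X+P<Y rewrite <ᵇ-false {Y} {suc (X + P)} X+P<Y with X <ᵇ Y
... | true  = refl
... | false = refl

near+far : ∀ P X Y → near P X Y + far P X Y ≡ ι (X <ᵇ Y)
near+far P X Y with <-≤-connex X Y
... | inj₂ Y≤X rewrite <ᵇ-false Y≤X = ι-≮ (≤-trans Y≤X (m≤m+n X P))
... | inj₁ X<Y with <-≤-connex (X + P) Y
...   | inj₁ X+P<Y rewrite <ᵇ-true X<Y | <ᵇ-false {Y} {suc (X + P)} X+P<Y | <ᵇ-true X+P<Y = refl
...   | inj₂ Y≤X+P rewrite <ᵇ-true X<Y | <ᵇ-true (s≤s Y≤X+P) | <ᵇ-false Y≤X+P = refl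

trichotomy-ι : ∀ {X Y} → X ≢ Y → ι (X <ᵇ Y) + ι (Y <ᵇ X) ≡ 1
trichotomy-ι {X} {Y} X≢Y with <-≤-connex X Y
... | inj₁ X<Y rewrite <ᵇ-true X<Y | <ᵇ-false (<⇒≤ X<Y) = refl
... | inj₂ Y≤X rewrite <ᵇ-false Y≤X | <ᵇ-true (≤∧≢⇒< Y≤X (X≢Y ∘ sym)) = refl

<-complement : ∀ {m n k l} → m + n ≡ k + l → m < k → l < n
<-complement {m} {n} {k} {l} eq m<k = +-cancelˡ-< m l n (subst (m + l <_) (sym eq) (+-monoˡ-< l m<k))

<ᵇ-complement : ∀ m n k l → m + n ≡ k + l → (m <ᵇ k) ≡ (l <ᵇ n)
<ᵇ-complement m n k l eq with <-≤-connex m k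
... | inj₁ m<k = trans (<ᵇ-true m<k) (sym (<ᵇ-true (<-complement eq m<k)))
... | inj₂ k≤m = trans (<ᵇ-false k≤m) (sym (<ᵇ-false (+-cancelˡ-≤ k n l
                   (subst (k + n ≤_) eq (+-monoˡ-≤ n k≤m)))))

module _ (P Q : ℕ) where
  private
    p = suc (2 * P)
    q = suc (2 * Q)

  -- Write X = q (i + 1) = t p + r. The only multiple of p that can lie in (X, X + P] is p (t + 1),
  -- and it does exactly when p - r ≤ P, that is P < r. So i contributes its sign in Gauss's lemma.
  near-count : ∀ i → i < P → ∑ Q (λ j → near P (q * suc i) (p * suc j)) ≡ ι (P <ᵇ (q * suc i) % p)
  near-count i i<P with <-≤-connex (q * suc i / p) Q
  ... | inj₁ t<Q = trans (∑-single Q _ t off t<Q) at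
    where
    X = q * suc i
    t = X / p
    r = X % p
    X≡ : X ≡ r + t * p
    X≡ = m≡m%n+[m/n]*n X p
    off : ∀ j → j ≢ t → near P X (p * suc j) ≡ 0
    off j j≢t with <-≤-connex j t
    ... | inj₁ j<t = near-below P (≤-trans (*-monoʳ-≤ p j<t)
          (≤-trans (≤-reflexive (*-comm p t)) (≤-trans (m≤n+m (t * p) r) (≤-reflexive (sym X≡)))))
    ... | inj₂ t≤j = near-beyond P (begin-strict
          X + P                ≡⟨ cong (_+ P) X≡ ⟩
          r + t * p + P        <⟨ +-mono-<-≤ (+-monoˡ-< (t * p) (m%n<n X p)) (≤-trans (m≤m+n P (P + 0)) (n≤1+n (2 * P))) ⟩
          p + t * p + p        ≡⟨ eq p t ⟩
          p * suc (suc t)      ≤⟨ *-monoʳ-≤ p (s≤s (≤∧≢⇒< t≤j (j≢t ∘ sym))) ⟩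
          p * suc j ∎)
      where
      open ≤-Reasoning
      eq : ∀ p t → p + t * p + p ≡ p * (2 + t)
      eq = solveℕ-∀
    X<Y : X < p * suc t
    X<Y = begin-strict
      X            ≡⟨ X≡ ⟩
      r + t * p    <⟨ +-monoˡ-< (t * p) (m%n<n X p) ⟩
      p + t * p    ≡⟨ *-comm (suc t) p ⟩
      p * suc t ∎
      where open ≤-Reasoning
    at : near P X (p * suc t) ≡ ι (P <ᵇ r)
    at rewrite <ᵇ-true X<Y = cong ι (<ᵇ-complement (p * suc t) r (suc (X + P)) P eq)
      where
      eq′ : ∀ P r t → suc (2 * P) * suc t + r ≡ suc (r + t * suc (2 * P) + P) + P
      eq′ = solveℕ-∀
      eq : p * suc t + r ≡ suc (X + P) + P
      eq = trans (eq′ P r t) (cong (λ x → suc (x + P) + P) (sym X≡))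
  -- Here p (t + 1) falls outside the rectangle, but X ≤ q P = P + 2PQ then forces r ≤ P, so no sign
  -- is lost.
  ... | inj₂ Q≤t = trans (∑-zero Q _ (λ j j<Q → near-below P (begin
      p * suc j    ≤⟨ *-monoʳ-≤ p (≤-trans j<Q Q≤t) ⟩
      p * t        ≡⟨ *-comm p t ⟩
      t * p        ≤⟨ m≤n+m (t * p) r ⟩
      r + t * p    ≡⟨ X≡ ⟨
      X ∎))) (sym (ι-≮ r≤P))
    where
    open ≤-Reasoning
    X = q * suc i
    t = X / p
    r = X % p
    X≡ : X ≡ r + t * p
    X≡ = m≡m%n+[m/n]*n X p
    eq : ∀ P Q → suc (2 * Q) * P ≡ P + Q * (2 * P)
    eq = solveℕ-∀
    r≤P : r ≤ P
    r≤P = +-cancelʳ-≤ (Q * (2 * P)) r P (begin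
      r + Q * (2 * P)     ≤⟨ +-monoʳ-≤ r (*-mono-≤ Q≤t (n≤1+n (2 * P))) ⟩
      r + t * p           ≡⟨ X≡ ⟨
      q * suc i           ≤⟨ *-monoʳ-≤ q i<P ⟩
      q * P               ≡⟨ eq P Q ⟩
      P + Q * (2 * P) ∎)

-- Rotating the rectangle by (i , j) ↦ (P − 1 − i , Q − 1 − j) exchanges the two far regions.
far-symmetric : ∀ P Q → let p = suc (2 * P) ; q = suc (2 * Q) in
  ∑ P (λ i → ∑ Q (λ j → far P (q * suc i) (p * suc j))) ≡
  ∑ P (λ i → ∑ Q (λ j → far Q (p * suc j) (q * suc i)))
far-symmetric P Q = trans (∑-reverse P _) (∑-cong P λ i i<P →
  trans (∑-reverse Q _) (∑-cong Q λ j j<Q → cong ι (<ᵇ-complement (q * suc (P ∸ suc i) + P) (q * suc i) (p * suc (Q ∸ suc j)) (p * suc j + Q) (rotate i j i<P j<Q))))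
  where
  open ≡-Reasoning
  p = suc (2 * P)
  q = suc (2 * Q)
  regroup : ∀ a b c d → (a * b + c) + a * d ≡ a * (b + d) + c
  regroup = solveℕ-∀
  -- Both sides are 2PQ + 2P + 2Q + 1: the strip widths P and Q are exactly what makes the rotation
  -- symmetric.
  eq : ∀ P Q → suc (2 * Q) * suc P + P ≡ suc (2 * P) * suc Q + Q
  eq = solveℕ-∀
  rotate : ∀ i j → i < P → j < Q →
    (q * suc (P ∸ suc i) + P) + q * suc i ≡ p * suc (Q ∸ suc j) + (p * suc j + Q)
  rotate i j i<P j<Q = begin
    (q * suc (P ∸ suc i) + P) + q * suc i     ≡⟨ regroup q (suc (P ∸ suc i)) P (suc i) ⟩
    q * suc ((P ∸ suc i) + suc i) + P         ≡⟨ cong (λ z → q * suc z + P) (m∸n+n≡m i<P) ⟩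
    q * suc P + P                             ≡⟨ eq P Q ⟩
    p * suc Q + Q                             ≡⟨ cong (λ z → p * suc z + Q) (m∸n+n≡m j<Q) ⟨
    p * suc ((Q ∸ suc j) + suc j) + Q         ≡⟨ regroup p (suc (Q ∸ suc j)) Q (suc j) ⟨
    (p * suc (Q ∸ suc j) + Q) + p * suc j     ≡⟨ +-assoc (p * suc (Q ∸ suc j)) Q _ ⟩
    p * suc (Q ∸ suc j) + (Q + p * suc j)     ≡⟨ cong (_+_ (p * suc (Q ∸ suc j))) (+-comm Q _) ⟩
    p * suc (Q ∸ suc j) + (p * suc j + Q) ∎

module Reciprocity (P Q : ℕ) (pp : Prime (suc (2 * P))) (pq : Prime (suc (2 * Q))) where
  private
    p = suc (2 * P)
    q = suc (2 * Q)
    module Modp = OddPrime P pp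
    module Modq = OddPrime Q pq

  module _ (p≢q : p ≢ q) where
    p∤q : ¬ + p ∣ℤ + q
    p∤q d = p≢q (prime-∣-prime pp pq (∣ℤ⇒∣ d))

    q∤p : ¬ + q ∣ℤ + p
    q∤p d = p≢q (sym (prime-∣-prime pq pp (∣ℤ⇒∣ d)))

    off-diagonal : ∀ i j → i < P → q * suc i ≢ p * suc j
    off-diagonal i j i<P eq =
      [ (λ d → p∤q (∣⇒∣ℤ d)) , (λ d → contradiction (∣∧<⇒≡0 d (Modp.<P⇒<p i<P)) λ ()) ]′
      (euclidsLemma q (suc i) pp (subst (p ∣_) (sym eq) (m∣m*n (suc j))))

    nearPQ nearQP farPQ farQP : ℕ → ℕ → ℕ
    nearPQ i j = near P (q * suc i) (p * suc j)
    nearQP i j = near Q (p * suc j) (q * suc i)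
    farPQ i j  = far P (q * suc i) (p * suc j)
    farQP i j  = far Q (p * suc j) (q * suc i)

    A B C : ℕ
    A = ∑ P (λ i → ∑ Q (nearPQ i))
    B = ∑ Q (λ j → ∑ P (λ i → nearQP i j))
    C = ∑ P (λ i → ∑ Q (farPQ i))

    legendre-p : legendre p (+ q) ≡ sgn A
    legendre-p = trans (Modp.legendre-gauss (+ q) p∤q) (cong sgn (∑-cong P λ i i<P →
      trans (cong (λ x → ι (P <ᵇ x %ℕ p)) (sym (ℤₚ.pos-* q (suc i)))) (sym (near-count P Q i i<P))))

    legendre-q : legendre q (+ p) ≡ sgn B
    legendre-q = trans (Modq.legendre-gauss (+ p) q∤p) (cong sgn (∑-cong Q λ j j<Q →
      trans (cong (λ x → ι (Q <ᵇ x %ℕ q)) (sym (ℤₚ.pos-* p (suc j)))) (sym (near-count Q P j j<Q))))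

    -- No point of the P by Q rectangle is on the diagonal, so each lies in exactly one of two near
    -- and two far regions. The far regions have equal size and drop out of the parity.
    count : (A + B) + (C + C) ≡ P * Q
    count = begin
      (A + B) + (C + C)                     ≡⟨ cong₂ (λ b c → (A + b) + (C + c)) (∑-swap Q P (λ j i → nearQP i j)) (far-symmetric P Q) ⟩
      (A + B′) + (C + D)                    ≡⟨ eq A B′ C D ⟩
      (A + C) + (B′ + D)                    ≡⟨ cong₂ _+_ (∑∑-+ nearPQ farPQ) (∑∑-+ nearQP farQP) ⟨
      ∑∑ (λ i j → nearPQ i j + farPQ i j) + ∑∑ (λ i j → nearQP i j + farQP i j)
                                            ≡⟨ ∑∑-+ (λ i j → nearPQ i j + farPQ i j) (λ i j → nearQP i j + farQP i j) ⟨
      ∑∑ (λ i j → (nearPQ i j + farPQ i j) + (nearQP i j + farQP i j))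
                                            ≡⟨ ∑-cong P (λ i i<P → ∑-cong Q λ j _ → each i j i<P) ⟩
      ∑ P (λ _ → ∑ Q (λ _ → 1))             ≡⟨ ∑-const P _ ⟩
      P * ∑ Q (λ _ → 1)                     ≡⟨ cong (P *_) (trans (∑-const Q 1) (*-identityʳ Q)) ⟩
      P * Q ∎
      where
      open ≡-Reasoning
      ∑∑ : (ℕ → ℕ → ℕ) → ℕ
      ∑∑ f = ∑ P (λ i → ∑ Q (f i))
      B′ = ∑∑ nearQP
      D = ∑∑ farQP
      eq : ∀ a b c d → (a + b) + (c + d) ≡ (a + c) + (b + d)
      eq = solveℕ-∀
      ∑∑-+ : ∀ f g → ∑∑ (λ i j → f i j + g i j) ≡ ∑∑ f + ∑∑ g
      ∑∑-+ f g = trans (∑-cong P (λ i _ → ∑-+ Q (f i) (g i))) (∑-+ P (λ i → ∑ Q (f i)) (λ i → ∑ Q (g i)))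
      each : ∀ i j → i < P → (nearPQ i j + farPQ i j) + (nearQP i j + farQP i j) ≡ 1
      each i j i<P = trans (cong₂ _+_ (near+far P (q * suc i) (p * suc j)) (near+far Q (p * suc j) (q * suc i)))
        (trichotomy-ι (off-diagonal i j i<P))

    reciprocity-distinct : legendre p (+ q) ≡ sgn (P * Q) *ℤ legendre q (+ p)
    reciprocity-distinct = begin
      legendre p (+ q)               ≡⟨ legendre-p ⟩
      sgn A                          ≡⟨ ℤₚ.*-identityʳ (sgn A) ⟨
      sgn A *ℤ + 1                   ≡⟨ cong (λ z → sgn A *ℤ (z *ℤ + 1)) (sgn-square B) ⟨
      sgn A *ℤ (sgn B *ℤ sgn B *ℤ + 1)  ≡⟨ cong (λ z → sgn A *ℤ (sgn B *ℤ sgn B *ℤ z)) (sgn-double C) ⟨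
      sgn A *ℤ (sgn B *ℤ sgn B *ℤ sgn (C + C))  ≡⟨ eq (sgn A) (sgn B) (sgn (C + C)) ⟩
      (sgn A *ℤ sgn B) *ℤ sgn (C + C) *ℤ sgn B  ≡⟨ cong (λ z → z *ℤ sgn (C + C) *ℤ sgn B) (sgn-+ A B) ⟨
      sgn (A + B) *ℤ sgn (C + C) *ℤ sgn B       ≡⟨ cong (_*ℤ sgn B) (sgn-+ (A + B) (C + C)) ⟨
      sgn ((A + B) + (C + C)) *ℤ sgn B          ≡⟨ cong₂ (λ n l → sgn n *ℤ l) count (sym legendre-q) ⟩
      sgn (P * Q) *ℤ legendre q (+ p) ∎
      where
      open ≡-Reasoning
      eq : ∀ a b c → a *ℤ (b *ℤ b *ℤ c) ≡ (a *ℤ b) *ℤ c *ℤ b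
      eq = solveℤ-∀

quadratic-reciprocity : ∀ P Q → Prime (suc (2 * P)) → Prime (suc (2 * Q)) →
  legendre (suc (2 * P)) (+ suc (2 * Q)) ≡ sgn (P * Q) *ℤ legendre (suc (2 * Q)) (+ suc (2 * P))
quadratic-reciprocity P Q pp pq with P ≟ Q
... | no  P≢Q  = Reciprocity.reciprocity-distinct P Q pp pq (P≢Q ∘ *-cancelˡ-≡ P Q 2 ∘ suc-injective)
... | yes refl = trans zero≡ (sym (trans (cong (sgn (P * P) *ℤ_) zero≡) (ℤₚ.*-zeroʳ (sgn (P * P)))))
  where
  zero≡ : legendre (suc (2 * P)) (+ suc (2 * P)) ≡ + 0
  zero≡ = OddPrime.legendre-divisible P pp (∣⇒∣ℤ ∣-refl)

-- The Jacobi symbol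

parity : ∀ n → (∃ λ k → n ≡ 2 * k) ⊎ (∃ λ k → n ≡ suc (2 * k))
parity zero = inj₁ (0 , refl)
parity (suc n) with parity n
... | inj₁ (k , refl) = inj₂ (k , refl)
... | inj₂ (k , refl) = inj₁ (suc k , cong suc (sym (+-suc k (k + 0))))

odd-*-odd : ∀ P N → suc (2 * P) * suc (2 * N) ≡ suc (2 * (P + N * suc (2 * P)))
odd-*-odd = solveℕ-∀

-- An odd number 2N + 1 is carried by its half N, the quantity in the exponents of the sign rules;
-- `P + N * suc (2 * P)` is the half of the product.
odd-prime-induction : ∀ {ℓ} (C : ℕ → Set ℓ) → C 0 →
  (∀ P N → Prime (suc (2 * P)) → C N → C (P + N * suc (2 * P))) → ∀ N → C N
odd-prime-induction C C0 Cp N = prime-induction (λ n → ∀ N → n ≡ suc (2 * N) → C N) base step (suc (2 * N)) (s≤s z≤n) N refl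
  where
  base : ∀ N → 1 ≡ suc (2 * N) → C N
  base zero    _ = C0
  step : ∀ p n → Prime p → 0 < n → (∀ N → n ≡ suc (2 * N) → C N) → ∀ M → p * n ≡ suc (2 * M) → C M
  step p n pp _ ih M eq with parity p | parity n
  ... | inj₁ (k , refl) | _ = contradiction (trans (sym (*-assoc 2 k n)) eq) (even≢odd (k * n) M)
  ... | inj₂ _ | inj₁ (k , refl) = contradiction (trans (shuffle p k) eq) (even≢odd (p * k) M)
    where shuffle : ∀ p k → 2 * (p * k) ≡ p * (2 * k)
          shuffle = solveℕ-∀
  ... | inj₂ (P , refl) | inj₂ (N , refl) =
    subst C (*-cancelˡ-≡ _ M 2 (suc-injective (trans (sym (odd-*-odd P N)) eq))) (Cp P N pp (ih N refl))

kronPrime-odd : ∀ P a → kronPrime (suc (2 * P)) a ≡ legendre (suc (2 * P)) a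
kronPrime-odd P a with (suc (2 * P)) ≡ᵇ 2 in eq
... | false = refl
... | true  = contradiction (sym (≡ᵇ-true eq)) (even≢odd 1 P)

kronecker-odd-step : ∀ a P N → Prime (suc (2 * P)) →
  kronecker a (suc (2 * (P + N * suc (2 * P)))) ≡ legendre (suc (2 * P)) a *ℤ kronecker a (suc (2 * N))
kronecker-odd-step a P N pp = begin
  kronecker a (suc (2 * (P + N * suc (2 * P))))                     ≡⟨ cong (kronecker a) (odd-*-odd P N) ⟨
  kronecker a (suc (2 * P) * suc (2 * N))                           ≡⟨ kronecker-prime-* a _ _ pp (s≤s z≤n) ⟩
  kronPrime (suc (2 * P)) a *ℤ kronecker a (suc (2 * N))            ≡⟨ cong (_*ℤ kronecker a (suc (2 * N))) (kronPrime-odd P a) ⟩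
  legendre (suc (2 * P)) a *ℤ kronecker a (suc (2 * N)) ∎
  where open ≡-Reasoning

interchange : ∀ a b c d → (a *ℤ b) *ℤ (c *ℤ d) ≡ (a *ℤ c) *ℤ (b *ℤ d)
interchange = solveℤ-∀

jacobi-trit : ∀ a N → Trit (kronecker a (suc (2 * N)))
jacobi-trit a = odd-prime-induction _ (subst Trit (sym (kronecker-1 a)) trit-+) λ P N pp ih →
  subst Trit (sym (kronecker-odd-step a P N pp)) (trit-* (legendre-trit (suc (2 * P)) (s≤s z≤n) a) ih)

jacobi-* : ∀ a b N → let n = suc (2 * N) in kronecker (a *ℤ b) n ≡ kronecker a n *ℤ kronecker b n
jacobi-* a b = odd-prime-induction _
  (trans (kronecker-1 (a *ℤ b)) (sym (cong₂ _*ℤ_ (kronecker-1 a) (kronecker-1 b)))) step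
  where
  open ≡-Reasoning
  step : ∀ P N → Prime (suc (2 * P)) → let n = suc (2 * N) ; m = suc (2 * (P + N * suc (2 * P))) in
    kronecker (a *ℤ b) n ≡ kronecker a n *ℤ kronecker b n →
    kronecker (a *ℤ b) m ≡ kronecker a m *ℤ kronecker b m
  step P N pp ih = begin
    kronecker (a *ℤ b) m                                       ≡⟨ kronecker-odd-step (a *ℤ b) P N pp ⟩
    legendre p (a *ℤ b) *ℤ kronecker (a *ℤ b) n                ≡⟨ cong₂ _*ℤ_ (OddPrime.legendre-* P pp a b) ih ⟩
    (legendre p a *ℤ legendre p b) *ℤ (kronecker a n *ℤ kronecker b n) ≡⟨ interchange (legendre p a) _ (kronecker a n) _ ⟩
    (legendre p a *ℤ kronecker a n) *ℤ (legendre p b *ℤ kronecker b n)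
      ≡⟨ cong₂ _*ℤ_ (kronecker-odd-step a P N pp) (kronecker-odd-step b P N pp) ⟨
    kronecker a m *ℤ kronecker b m ∎
    where
    p = suc (2 * P)
    n = suc (2 * N)
    m = suc (2 * (P + N * p))

jacobi-*ℕ : ∀ a b N → let n = suc (2 * N) in kronecker (+ (a * b)) n ≡ kronecker (+ a) n *ℤ kronecker (+ b) n
jacobi-*ℕ a b N = trans (cong (λ z → kronecker z (suc (2 * N))) (ℤₚ.pos-* a b)) (jacobi-* (+ a) (+ b) N)

≋-weaken : ∀ {a b m n} → m ∣ n → a ≋ b [ n ] → a ≋ b [ m ]
≋-weaken m∣n (mod-∣ d) = mod-∣ (∣ℤ-trans (∣⇒∣ℤ m∣n) d)

jacobi-≋ : ∀ {a b} N → a ≋ b [ suc (2 * N) ] → kronecker a (suc (2 * N)) ≡ kronecker b (suc (2 * N))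
jacobi-≋ {a} {b} = odd-prime-induction (λ N → a ≋ b [ suc (2 * N) ] → kronecker a (suc (2 * N)) ≡ kronecker b (suc (2 * N)))
  (λ _ → trans (kronecker-1 a) (sym (kronecker-1 b))) λ P N pp ih e →
  let e′ = subst (a ≋ b [_]) (sym (odd-*-odd P N)) e in
  trans (kronecker-odd-step a P N pp) (trans
    (cong₂ _*ℤ_ (OddPrime.legendre-≋ P pp (≋-weaken (m∣m*n (suc (2 * N))) e′)) (ih (≋-weaken (n∣m*n (suc (2 * P))) e′)))
    (sym (kronecker-odd-step b P N pp)))

sgn-+-2* : ∀ m n → sgn (m + 2 * n) ≡ sgn m
sgn-+-2* m n = trans (sgn-+ m (2 * n)) (trans (cong (λ k → sgn m *ℤ sgn (n + k)) (+-identityʳ n))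
  (trans (cong (sgn m *ℤ_) (sgn-double n)) (ℤₚ.*-identityʳ (sgn m))))

-- The half of the product exceeds P + N by the even number 2NP. This makes the exponents in
-- reciprocity additive over prime factors.
sgn-half-* : ∀ K P N → sgn (K * (P + N * suc (2 * P))) ≡ sgn (K * P) *ℤ sgn (K * N)
sgn-half-* K P N = begin
  sgn (K * (P + N * suc (2 * P)))        ≡⟨ cong sgn (eq K P N) ⟩
  sgn (K * P + K * N + 2 * (K * N * P))  ≡⟨ sgn-+-2* (K * P + K * N) (K * N * P) ⟩
  sgn (K * P + K * N)                    ≡⟨ sgn-+ (K * P) (K * N) ⟩
  sgn (K * P) *ℤ sgn (K * N) ∎
  where
  open ≡-Reasoning
  eq : ∀ K P N → K * (P + N * suc (2 * P)) ≡ K * P + K * N + 2 * (K * N * P)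
  eq = solveℕ-∀

jacobi--1 : ∀ N → kronecker -[1+ 0 ] (suc (2 * N)) ≡ sgn N
jacobi--1 = odd-prime-induction _ refl λ P N pp ih → begin
  kronecker -[1+ 0 ] (suc (2 * (P + N * suc (2 * P))))                     ≡⟨ kronecker-odd-step -[1+ 0 ] P N pp ⟩
  legendre (suc (2 * P)) -[1+ 0 ] *ℤ kronecker -[1+ 0 ] (suc (2 * N))      ≡⟨ cong₂ _*ℤ_ (OddPrime.legendre--1 P pp) ih ⟩
  sgn P *ℤ sgn N                         ≡⟨ cong₂ (λ x y → sgn x *ℤ sgn y) (*-identityˡ P) (*-identityˡ N) ⟨
  sgn (1 * P) *ℤ sgn (1 * N)             ≡⟨ sgn-half-* 1 P N ⟨
  sgn (1 * (P + N * suc (2 * P)))        ≡⟨ cong sgn (*-identityˡ (P + N * suc (2 * P))) ⟩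
  sgn (P + N * suc (2 * P)) ∎
  where open ≡-Reasoning

-- Reciprocity is extended one entry at a time: here the lower entry stays prime while the upper one
-- is factored, and `jacobi-reciprocity` then factors the other.
legendre-reciprocity : ∀ P → Prime (suc (2 * P)) → ∀ M →
  legendre (suc (2 * P)) (+ suc (2 * M)) ≡ sgn (P * M) *ℤ kronecker (+ suc (2 * P)) (suc (2 * M))
legendre-reciprocity P pp = odd-prime-induction _ base step
  where
  open ≡-Reasoning
  p = suc (2 * P)
  base : legendre p (+ 1) ≡ sgn (P * 0) *ℤ kronecker (+ p) 1
  base = trans (OddPrime.legendre-unique P pp trit-+ (≋-reflexive (ℤₚ.^-zeroˡ P)))
    (sym (cong₂ _*ℤ_ (cong sgn (*-zeroʳ P)) (kronecker-1 (+ p))))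
  step : ∀ R M → Prime (suc (2 * R)) → legendre p (+ suc (2 * M)) ≡ sgn (P * M) *ℤ kronecker (+ p) (suc (2 * M)) →
    legendre p (+ suc (2 * (R + M * suc (2 * R)))) ≡
    sgn (P * (R + M * suc (2 * R))) *ℤ kronecker (+ p) (suc (2 * (R + M * suc (2 * R))))
  step R M pr ih = begin
    legendre p (+ suc (2 * (R + M * r)))                          ≡⟨ cong (λ z → legendre p (+ z)) (odd-*-odd R M) ⟨
    legendre p (+ (r * m))                                        ≡⟨ cong (legendre p) (ℤₚ.pos-* r m) ⟩
    legendre p (+ r *ℤ + m)                                       ≡⟨ OddPrime.legendre-* P pp (+ r) (+ m) ⟩
    legendre p (+ r) *ℤ legendre p (+ m)                          ≡⟨ cong₂ _*ℤ_ (quadratic-reciprocity P R pp pr) ih ⟩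
    (sgn (P * R) *ℤ legendre r (+ p)) *ℤ (sgn (P * M) *ℤ kronecker (+ p) m)
      ≡⟨ interchange (sgn (P * R)) (legendre r (+ p)) (sgn (P * M)) _ ⟩
    (sgn (P * R) *ℤ sgn (P * M)) *ℤ (legendre r (+ p) *ℤ kronecker (+ p) m)
      ≡⟨ cong₂ _*ℤ_ (sgn-half-* P R M) (kronecker-odd-step (+ p) R M pr) ⟨
    sgn (P * (R + M * r)) *ℤ kronecker (+ p) (suc (2 * (R + M * r))) ∎
    where
    r = suc (2 * R)
    m = suc (2 * M)

jacobi-reciprocity : ∀ M N →
  kronecker (+ suc (2 * M)) (suc (2 * N)) ≡ sgn (M * N) *ℤ kronecker (+ suc (2 * N)) (suc (2 * M))
jacobi-reciprocity M = odd-prime-induction _ base step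
  where
  open ≡-Reasoning
  m = suc (2 * M)
  kronecker-1ˡ : kronecker (+ 1) m ≡ + 1
  kronecker-1ˡ = odd-prime-induction (λ N → kronecker (+ 1) (suc (2 * N)) ≡ + 1) refl
    (λ P N pp ih → trans (kronecker-odd-step (+ 1) P N pp)
      (cong₂ _*ℤ_ (OddPrime.legendre-unique P pp trit-+ (≋-reflexive (ℤₚ.^-zeroˡ P))) ih)) M
  base : kronecker (+ m) 1 ≡ sgn (M * 0) *ℤ kronecker (+ 1) m
  base = trans (kronecker-1 (+ m)) (sym (cong₂ _*ℤ_ (cong sgn (*-zeroʳ M)) kronecker-1ˡ))
  step : ∀ P N → Prime (suc (2 * P)) → kronecker (+ m) (suc (2 * N)) ≡ sgn (M * N) *ℤ kronecker (+ suc (2 * N)) m →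
    kronecker (+ m) (suc (2 * (P + N * suc (2 * P)))) ≡
    sgn (M * (P + N * suc (2 * P))) *ℤ kronecker (+ suc (2 * (P + N * suc (2 * P)))) m
  step P N pp ih = begin
    kronecker (+ m) (suc (2 * (P + N * p)))                       ≡⟨ kronecker-odd-step (+ m) P N pp ⟩
    legendre p (+ m) *ℤ kronecker (+ m) n                         ≡⟨ cong₂ _*ℤ_ (legendre-reciprocity P pp M) ih ⟩
    (sgn (P * M) *ℤ kronecker (+ p) m) *ℤ (sgn (M * N) *ℤ kronecker (+ n) m)
      ≡⟨ cong (λ k → (sgn k *ℤ kronecker (+ p) m) *ℤ (sgn (M * N) *ℤ kronecker (+ n) m)) (*-comm P M) ⟩
    (sgn (M * P) *ℤ kronecker (+ p) m) *ℤ (sgn (M * N) *ℤ kronecker (+ n) m)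
      ≡⟨ interchange (sgn (M * P)) (kronecker (+ p) m) (sgn (M * N)) _ ⟩
    (sgn (M * P) *ℤ sgn (M * N)) *ℤ (kronecker (+ p) m *ℤ kronecker (+ n) m)
      ≡⟨ cong₂ _*ℤ_ (sgn-half-* M P N) (jacobi-*ℕ p n M) ⟨
    sgn (M * (P + N * p)) *ℤ kronecker (+ (p * n)) m
      ≡⟨ cong (λ z → sgn (M * (P + N * p)) *ℤ kronecker (+ z) m) (odd-*-odd P N) ⟩
    sgn (M * (P + N * p)) *ℤ kronecker (+ suc (2 * (P + N * p))) m ∎
    where
    p = suc (2 * P)
    n = suc (2 * N)

-- The supplementary law for 2

sgn-consecutive : ∀ N → sgn (N * suc N) ≡ + 1
sgn-consecutive zero    = refl
sgn-consecutive (suc N) = trans (cong sgn (eq N)) (trans (sgn-+-2* (N * suc N) (suc N)) (sgn-consecutive N))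
  where eq : ∀ N → suc N * suc (suc N) ≡ N * suc N + 2 * suc N
        eq = solveℕ-∀

-- With n = 2N + 3: (2/n) = (−1/n)((n − 2)/n), and reciprocity turns ((n − 2)/n) into (2/(n − 2)).
jacobi-2-step : ∀ N → kronecker (+ 2) (suc (2 * suc N)) ≡ sgn (suc N) *ℤ kronecker (+ 2) (suc (2 * N))
jacobi-2-step N = begin
  kronecker (+ 2) n                                     ≡⟨ jacobi-* -[1+ 0 ] -[1+ 1 ] (suc N) ⟩
  kronecker -[1+ 0 ] n *ℤ kronecker -[1+ 1 ] n          ≡⟨ cong₂ _*ℤ_ (jacobi--1 (suc N)) (jacobi-≋ (suc N) -2≋m) ⟩
  sgn (suc N) *ℤ kronecker (+ m) n                      ≡⟨ cong (sgn (suc N) *ℤ_) (jacobi-reciprocity N (suc N)) ⟩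
  sgn (suc N) *ℤ (sgn (N * suc N) *ℤ kronecker (+ n) m)
    ≡⟨ cong (λ s → sgn (suc N) *ℤ (s *ℤ kronecker (+ n) m)) (sgn-consecutive N) ⟩
  sgn (suc N) *ℤ (+ 1 *ℤ kronecker (+ n) m)             ≡⟨ cong (sgn (suc N) *ℤ_) (ℤₚ.*-identityˡ (kronecker (+ n) m)) ⟩
  sgn (suc N) *ℤ kronecker (+ n) m                      ≡⟨ cong (sgn (suc N) *ℤ_) (jacobi-≋ N n≋2) ⟩
  sgn (suc N) *ℤ kronecker (+ 2) m ∎
  where
  open ≡-Reasoning
  n = suc (2 * suc N)
  m = suc (2 * N)
  n≡2+m : n ≡ 2 + m
  n≡2+m = cong (suc ∘ suc) (+-suc N (N + 0))
  -2≋m : -[1+ 1 ] ≋ + m [ n ]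
  -2≋m = mod-∣ (dividesℤ -[1+ 0 ] (begin
    -[1+ 1 ] -ℤ + m         ≡⟨ eq (+ m) ⟩
    -[1+ 0 ] *ℤ (+ 2 +ℤ + m) ≡⟨ cong (-[1+ 0 ] *ℤ_) (ℤₚ.pos-+ 2 m) ⟨
    -[1+ 0 ] *ℤ + (2 + m)   ≡⟨ cong (λ z → -[1+ 0 ] *ℤ + z) n≡2+m ⟨
    -[1+ 0 ] *ℤ + n ∎))
    where eq : ∀ m → -[1+ 1 ] -ℤ m ≡ -[1+ 0 ] *ℤ (+ 2 +ℤ m)
          eq = solveℤ-∀
  n≋2 : + n ≋ + 2 [ m ]
  n≋2 = mod-∣ (dividesℤ (+ 1) (begin
    + n -ℤ + 2          ≡⟨ cong (λ z → + z -ℤ + 2) n≡2+m ⟩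
    + (2 + m) -ℤ + 2    ≡⟨ cong (_-ℤ + 2) (ℤₚ.pos-+ 2 m) ⟩
    + 2 +ℤ + m -ℤ + 2   ≡⟨ eq (+ m) ⟩
    + 1 *ℤ + m ∎))
    where eq : ∀ m → + 2 +ℤ m -ℤ + 2 ≡ + 1 *ℤ m
          eq = solveℤ-∀

kron2-≋ : ∀ {a b} → a ≋ b [ 8 ] → kron2 a ≡ kron2 b
kron2-≋ {a} {b} e = cong
  (λ r → if (r ≡ᵇ 1) ∨ (r ≡ᵇ 7) then + 1 else (if (r ≡ᵇ 3) ∨ (r ≡ᵇ 5) then -[1+ 0 ] else + 0))
  (%ℕ-unique {a = a} (≋-trans e (≋-%ℕ b)) (n%ℕd<d b 8))

shift-≋ : ∀ n k m → + (n + k * m) ≋ + n [ m ]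
shift-≋ n k m = mod-∣ (dividesℤ (+ k) (begin
  + (n + k * m) -ℤ + n          ≡⟨ cong (_-ℤ + n) (trans (ℤₚ.pos-+ n (k * m)) (cong (+ n +ℤ_) (ℤₚ.pos-* k m))) ⟩
  (+ n +ℤ + k *ℤ + m) -ℤ + n    ≡⟨ eq (+ n) (+ k *ℤ + m) ⟩
  + k *ℤ + m ∎))
  where
  open ≡-Reasoning
  eq : ∀ n r → (n +ℤ r) -ℤ n ≡ r
  eq = solveℤ-∀

-- Four applications of `jacobi-2-step` collect the even exponent 4N + 10, so (2/n) has period 8
-- like `kron2`; n = 1, 3, 5, 7 are computed.
jacobi-2 : ∀ N → kronecker (+ 2) (suc (2 * N)) ≡ kron2 (+ suc (2 * N))
jacobi-2 0 = refl
jacobi-2 1 = refl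
jacobi-2 2 = refl
jacobi-2 3 = refl
jacobi-2 (suc (suc (suc (suc N)))) = begin
  J (4 + N)                                                   ≡⟨ jacobi-2-step (3 + N) ⟩
  sgn (4 + N) *ℤ J (3 + N)                                    ≡⟨ cong (sgn (4 + N) *ℤ_) (jacobi-2-step (2 + N)) ⟩
  sgn (4 + N) *ℤ (sgn (3 + N) *ℤ J (2 + N))                   ≡⟨ cong (λ z → sgn (4 + N) *ℤ (sgn (3 + N) *ℤ z)) (jacobi-2-step (1 + N)) ⟩
  sgn (4 + N) *ℤ (sgn (3 + N) *ℤ (sgn (2 + N) *ℤ J (1 + N)))
    ≡⟨ cong (λ z → sgn (4 + N) *ℤ (sgn (3 + N) *ℤ (sgn (2 + N) *ℤ z))) (jacobi-2-step N) ⟩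
  sgn (4 + N) *ℤ (sgn (3 + N) *ℤ (sgn (2 + N) *ℤ (sgn (1 + N) *ℤ J N)))  ≡⟨ eq (sgn N) (J N) ⟩
  (sgn N *ℤ sgn N) *ℤ (sgn N *ℤ sgn N) *ℤ J N                 ≡⟨ cong (λ z → z *ℤ z *ℤ J N) (sgn-square N) ⟩
  + 1 *ℤ J N                                                  ≡⟨ ℤₚ.*-identityˡ (J N) ⟩
  J N                                                         ≡⟨ jacobi-2 N ⟩
  kron2 (+ suc (2 * N))                                       ≡⟨ kron2-≋ (shift-≋ (suc (2 * N)) 1 8) ⟨
  kron2 (+ (suc (2 * N) + 1 * 8))                             ≡⟨ cong (λ z → kron2 (+ z)) (eq₂ N) ⟩
  kron2 (+ suc (2 * (4 + N))) ∎
  where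
  open ≡-Reasoning
  J : ℕ → ℤ
  J N = kronecker (+ 2) (suc (2 * N))
  eq : ∀ s j → (-[1+ 0 ] *ℤ (-[1+ 0 ] *ℤ (-[1+ 0 ] *ℤ (-[1+ 0 ] *ℤ s)))) *ℤ ((-[1+ 0 ] *ℤ (-[1+ 0 ] *ℤ (-[1+ 0 ] *ℤ s)))
    *ℤ ((-[1+ 0 ] *ℤ (-[1+ 0 ] *ℤ s)) *ℤ ((-[1+ 0 ] *ℤ s) *ℤ j))) ≡ (s *ℤ s) *ℤ (s *ℤ s) *ℤ j
  eq = solveℤ-∀
  eq₂ : ∀ N → suc (2 * N) + 1 * 8 ≡ suc (2 * (4 + N))
  eq₂ = solveℕ-∀

jacobi-4 : ∀ N → kronecker (+ 4) (suc (2 * N)) ≡ + 1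
jacobi-4 N = trans (jacobi-* (+ 2) (+ 2) N) (square N)
  where
  open ≡-Reasoning
  J : ℕ → ℤ
  J N = kronecker (+ 2) (suc (2 * N))
  square : ∀ N → J N *ℤ J N ≡ + 1
  square zero    = refl
  square (suc N) = begin
    J (suc N) *ℤ J (suc N)                                ≡⟨ cong (λ z → z *ℤ z) (jacobi-2-step N) ⟩
    (sgn (suc N) *ℤ J N) *ℤ (sgn (suc N) *ℤ J N)          ≡⟨ interchange (sgn (suc N)) (J N) (sgn (suc N)) (J N) ⟩
    (sgn (suc N) *ℤ sgn (suc N)) *ℤ (J N *ℤ J N)          ≡⟨ cong₂ _*ℤ_ (sgn-square (suc N)) (square N) ⟩
    + 1 ∎

-- Reciprocity with an even entry, and periods of the symbol

odd-part-induction : ∀ {ℓ} (C : ℕ → Set ℓ) → (∀ N → C (suc (2 * N))) →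
  (∀ m → 0 < m → C m → C (2 * m)) → ∀ m → 0 < m → C m
odd-part-induction C Codd Cdouble = <-rec (λ m → 0 < m → C m) step
  where
  step : ∀ m → (∀ {k} → k < m → 0 < k → C k) → 0 < m → C m
  step m rec 0<m with parity m
  ... | inj₂ (N , refl) = Codd N
  ... | inj₁ (k , refl) = Cdouble k 0<k (rec (m<m+n k (≤-trans 0<k (≤-reflexive (sym (+-identityʳ k))))) 0<k)
    where
    0<k : 0 < k
    0<k = n≢0⇒n>0 λ { refl → contradiction 0<m λ () }

kronecker-double : ∀ a m → 0 < m → kronecker a (2 * m) ≡ kron2 a *ℤ kronecker a m
kronecker-double a m 0<m = kronecker-prime-* a 2 m prime[2] 0<m

-- g corrects the sign in the reciprocity law between x = 2M + 1 and an arbitrary y > 0.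
twisted-reciprocity : ∀ M (g : ℕ → ℤ) → (∀ N → g (suc (2 * N)) ≡ sgn (M * N)) → (∀ m → 0 < m → g (2 * m) ≡ g m) →
  ∀ y → 0 < y → kronecker (+ suc (2 * M)) y *ℤ g y ≡ kronecker (+ y) (suc (2 * M))
twisted-reciprocity M g g-odd g-double = odd-part-induction _ odd double
  where
  open ≡-Reasoning
  x = suc (2 * M)
  odd : ∀ N → kronecker (+ x) (suc (2 * N)) *ℤ g (suc (2 * N)) ≡ kronecker (+ suc (2 * N)) x
  odd N = begin
    kronecker (+ x) n *ℤ g n                                     ≡⟨ cong₂ _*ℤ_ (jacobi-reciprocity M N) (g-odd N) ⟩
    (sgn (M * N) *ℤ kronecker (+ n) x) *ℤ sgn (M * N)            ≡⟨ eq (sgn (M * N)) (kronecker (+ n) x) ⟩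
    (sgn (M * N) *ℤ sgn (M * N)) *ℤ kronecker (+ n) x            ≡⟨ cong (_*ℤ kronecker (+ n) x) (sgn-square (M * N)) ⟩
    + 1 *ℤ kronecker (+ n) x                                     ≡⟨ ℤₚ.*-identityˡ _ ⟩
    kronecker (+ n) x ∎
    where
    n = suc (2 * N)
    eq : ∀ s k → (s *ℤ k) *ℤ s ≡ (s *ℤ s) *ℤ k
    eq = solveℤ-∀
  double : ∀ m → 0 < m → kronecker (+ x) m *ℤ g m ≡ kronecker (+ m) x →
    kronecker (+ x) (2 * m) *ℤ g (2 * m) ≡ kronecker (+ (2 * m)) x
  double m 0<m ih = begin
    kronecker (+ x) (2 * m) *ℤ g (2 * m)            ≡⟨ cong₂ _*ℤ_ (kronecker-double (+ x) m 0<m) (g-double m 0<m) ⟩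
    (kron2 (+ x) *ℤ kronecker (+ x) m) *ℤ g m       ≡⟨ ℤₚ.*-assoc (kron2 (+ x)) _ _ ⟩
    kron2 (+ x) *ℤ (kronecker (+ x) m *ℤ g m)       ≡⟨ cong₂ _*ℤ_ (sym (jacobi-2 M)) ih ⟩
    kronecker (+ 2) x *ℤ kronecker (+ m) x          ≡⟨ jacobi-*ℕ 2 m M ⟨
    kronecker (+ (2 * m)) x ∎

reciprocity-1mod4 : ∀ M y → 0 < y → kronecker (+ suc (2 * (2 * M))) y ≡ kronecker (+ y) (suc (2 * (2 * M)))
reciprocity-1mod4 M y 0<y = trans (sym (ℤₚ.*-identityʳ (kronecker (+ suc (2 * (2 * M))) y)))
  (twisted-reciprocity (2 * M) (λ _ → + 1) (λ N → sym (trans (cong sgn (*-assoc 2 M N)) (sgn-+-2* 0 (M * N)))) (λ _ _ → refl) y 0<y)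

-- For x = 4M + 3 the exponent (2M + 1) N has the parity of N. The symbol (-1/·) has this sign at 2N
-- + 1, and (-1/2) = 1 makes it blind to factors 2.
reciprocity-3mod4 : ∀ M y → 0 < y →
  kronecker (+ suc (2 * suc (2 * M))) y *ℤ kronecker -[1+ 0 ] y ≡ kronecker (+ y) (suc (2 * suc (2 * M)))
reciprocity-3mod4 M = twisted-reciprocity (suc (2 * M)) (kronecker -[1+ 0 ])
  (λ N → trans (jacobi--1 N) (sym (trans (cong sgn (cong (_+_ N) (*-assoc 2 M N))) (sgn-+-2* N (M * N)))))
  (λ m 0<m → trans (kronecker-double -[1+ 0 ] m 0<m) (ℤₚ.*-identityˡ (kronecker -[1+ 0 ] m)))

-- The 4 in the modulus pays for the factors 2 of m: each is evaluated by `kron2`, which depends on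
-- the class modulo 8, and 8 divides 4 (2m).
kronecker-≋ : ∀ {a b} m → 0 < m → a ≋ b [ 4 * m ] → kronecker a m ≡ kronecker b m
kronecker-≋ {a} {b} = odd-part-induction (λ m → a ≋ b [ 4 * m ] → kronecker a m ≡ kronecker b m)
  (λ N e → jacobi-≋ N (≋-weaken (n∣m*n 4) e))
  λ m 0<m ih e → trans (kronecker-double a m 0<m) (trans
    (cong₂ _*ℤ_ (kron2-≋ (≋-weaken (divides m (eq₁ m)) e)) (ih (≋-weaken (divides 2 (eq₂ m)) e)))
    (sym (kronecker-double b m 0<m)))
  where
  eq₁ : ∀ m → 4 * (2 * m) ≡ m * 8
  eq₁ = solveℕ-∀
  eq₂ : ∀ m → 4 * (2 * m) ≡ 2 * (4 * m)
  eq₂ = solveℕ-∀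

-- Adding multiples of 4m keeps the lower entry in its class modulo 4, so the same form of
-- reciprocity applies before and after; in between, that entry stands on top, where `kronecker-≋`
-- applies.
jacobi-period : ∀ m N k → 0 < m → kronecker (+ m) (suc (2 * N) + k * (4 * m)) ≡ kronecker (+ m) (suc (2 * N))
jacobi-period m N k 0<m with parity N
... | inj₁ (M , refl) = begin
  kronecker (+ m) (suc (2 * (2 * M)) + k * (4 * m))     ≡⟨ cong (kronecker (+ m)) (eq M k m) ⟩
  kronecker (+ m) (suc (2 * (2 * (M + k * m))))         ≡⟨ reciprocity-1mod4 (M + k * m) m 0<m ⟨
  kronecker (+ suc (2 * (2 * (M + k * m)))) m           ≡⟨ cong (λ z → kronecker (+ z) m) (eq M k m) ⟨
  kronecker (+ (suc (2 * (2 * M)) + k * (4 * m))) m     ≡⟨ kronecker-≋ m 0<m (shift-≋ (suc (2 * (2 * M))) k (4 * m)) ⟩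
  kronecker (+ suc (2 * (2 * M))) m                     ≡⟨ reciprocity-1mod4 M m 0<m ⟩
  kronecker (+ m) (suc (2 * (2 * M))) ∎
  where
  open ≡-Reasoning
  eq : ∀ M k m → suc (2 * (2 * M)) + k * (4 * m) ≡ suc (2 * (2 * (M + k * m)))
  eq = solveℕ-∀
... | inj₂ (M , refl) = begin
  kronecker (+ m) (n + k * (4 * m))                     ≡⟨ cong (kronecker (+ m)) (eq M k m) ⟩
  kronecker (+ m) (suc (2 * suc (2 * (M + k * m))))     ≡⟨ reciprocity-3mod4 (M + k * m) m 0<m ⟨
  kronecker (+ suc (2 * suc (2 * (M + k * m)))) m *ℤ kronecker -[1+ 0 ] m
    ≡⟨ cong (λ z → kronecker (+ z) m *ℤ kronecker -[1+ 0 ] m) (eq M k m) ⟨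
  kronecker (+ (n + k * (4 * m))) m *ℤ kronecker -[1+ 0 ] m
    ≡⟨ cong (_*ℤ kronecker -[1+ 0 ] m) (kronecker-≋ m 0<m (shift-≋ n k (4 * m))) ⟩
  kronecker (+ n) m *ℤ kronecker -[1+ 0 ] m             ≡⟨ reciprocity-3mod4 M m 0<m ⟩
  kronecker (+ m) n ∎
  where
  open ≡-Reasoning
  n = suc (2 * suc (2 * M))
  eq : ∀ M k m → suc (2 * suc (2 * M)) + k * (4 * m) ≡ suc (2 * suc (2 * (M + k * m)))
  eq = solveℕ-∀

jacobi-4* : ∀ m N → kronecker (+ (4 * m)) (suc (2 * N)) ≡ kronecker (+ m) (suc (2 * N))
jacobi-4* m N = trans (jacobi-*ℕ 4 m N)
  (trans (cong (_*ℤ kronecker (+ m) (suc (2 * N))) (jacobi-4 N)) (ℤₚ.*-identityˡ _))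

-- Since (4m/n) = (m/n), the period 4m of (m/·) is the upper entry itself. This is used for y = 4η
-- and for v = 4w.
jacobi-period-4* : ∀ m N k → 0 < m →
  kronecker (+ (4 * m)) (suc (2 * N) + k * (4 * m)) ≡ kronecker (+ (4 * m)) (suc (2 * N))
jacobi-period-4* m N k 0<m = begin
  kronecker (+ (4 * m)) (suc (2 * N) + k * (4 * m))         ≡⟨ cong (kronecker (+ (4 * m))) (eq N k m) ⟩
  kronecker (+ (4 * m)) (suc (2 * (N + 2 * (k * m))))       ≡⟨ jacobi-4* m (N + 2 * (k * m)) ⟩
  kronecker (+ m) (suc (2 * (N + 2 * (k * m))))             ≡⟨ cong (kronecker (+ m)) (eq N k m) ⟨
  kronecker (+ m) (suc (2 * N) + k * (4 * m))               ≡⟨ jacobi-period m N k 0<m ⟩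
  kronecker (+ m) (suc (2 * N))                             ≡⟨ jacobi-4* m N ⟨
  kronecker (+ (4 * m)) (suc (2 * N)) ∎
  where
  open ≡-Reasoning
  eq : ∀ N k m → suc (2 * N) + k * (4 * m) ≡ suc (2 * (N + 2 * (k * m)))
  eq = solveℕ-∀

-- Nonvanishing symbols and translation to a coprime entry

NoCommonPrime : ℕ → ℕ → Set
NoCommonPrime m n = ∀ {p} → Prime p → p ∣ m → ¬ p ∣ n

jacobi-nonzero : ∀ a N → NoCommonPrime (suc (2 * N)) a → kronecker (+ a) (suc (2 * N)) ≢ + 0
jacobi-nonzero a = odd-prime-induction (λ N → NoCommonPrime (suc (2 * N)) a → kronecker (+ a) (suc (2 * N)) ≢ + 0)
  (λ _ eq → contradiction (trans (sym (kronecker-1 (+ a))) eq) λ ()) step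
  where
  legendre-nonzero : ∀ p → 0 < p → ¬ p ∣ a → legendre p (+ a) ≢ + 0
  legendre-nonzero p 0<p p∤a with legendre p (+ a) | legendre-spec p 0<p (+ a)
  ... | _ | divisible d    = λ _ → p∤a (∣ℤ⇒∣ d)
  ... | _ | residue _ _ _  = λ ()
  ... | _ | nonresidue _ _ = λ ()
  step : ∀ P N → Prime (suc (2 * P)) → (NoCommonPrime (suc (2 * N)) a → kronecker (+ a) (suc (2 * N)) ≢ + 0) →
    NoCommonPrime (suc (2 * (P + N * suc (2 * P)))) a → kronecker (+ a) (suc (2 * (P + N * suc (2 * P)))) ≢ + 0
  step P N pp ih ncp eq =
    [ legendre-nonzero p (s≤s z≤n) (ncp pp (subst (p ∣_) (odd-*-odd P N) (m∣m*n (suc (2 * N)))))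
    , ih (λ {q} pq q∣n → ncp pq (subst (q ∣_) (odd-*-odd P N) (∣n⇒∣m*n p q∣n)))
    ]′ (ℤₚ.i*j≡0⇒i≡0∨j≡0 (legendre p (+ a)) (trans (sym (kronecker-odd-step (+ a) P N pp)) eq))
    where p = suc (2 * P)

-- When q divides a + tc, t becomes t + y: primes of y see no change, while q divides neither y,
-- which has no prime in common with a + tc, nor c, since it would then divide a.
coprime-translate : ∀ a c → NoCommonPrime a c → ∀ y → 0 < y → ∃ λ t → NoCommonPrime (a + t * c) y
coprime-translate a c ncp = prime-induction _ (0 , λ pp _ p∣1 → >⇒≢ (prime≥2 pp) (∣1⇒≡1 p∣1)) step
  where
  step : ∀ q y → Prime q → 0 < y → (∃ λ t → NoCommonPrime (a + t * c) y) → ∃ λ t → NoCommonPrime (a + t * c) (q * y)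
  step q y pq 0<y (t , h) with q ∣? a + t * c
  ... | no q∤ = t , λ pp p∣ p∣qy → [ (λ p∣q → q∤ (subst (_∣ _) (prime-∣-prime pp pq p∣q) p∣)) , h pp p∣ ]′ (euclidsLemma q y pp p∣qy)
  ... | yes q∣ = t + y , λ {p} pp p∣ p∣qy →
    [ (λ p∣q → q-case (subst (_∣ _) (prime-∣-prime pp pq p∣q) p∣))
    , (λ p∣y → h pp (∣m+n∣m⇒∣n (subst (p ∣_) (trans (expand a t y c) (+-comm (a + t * c) (y * c))) p∣) (∣m⇒∣m*n c p∣y)) p∣y)
    ]′ (euclidsLemma q y pp p∣qy)
    where
    expand : ∀ a t y c → a + (t + y) * c ≡ (a + t * c) + y * c
    expand = solveℕ-∀
    q-case : ¬ q ∣ a + (t + y) * c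
    q-case d = [ h pq q∣ , (λ q∣c → ncp pq (∣m+n∣m⇒∣n (subst (q ∣_) (+-comm a (t * c)) q∣) (∣n⇒∣m*n t q∣c)) q∣c) ]′
      (euclidsLemma y c pq (∣m+n∣m⇒∣n (subst (q ∣_) (expand a t y c) d) q∣))

-- Invariance of the symbol under Ψ

Odd 1mod4 : ℕ → Set
Odd n   = ∃ λ N → n ≡ suc (2 * N)
1mod4 n = ∃ λ N → n ≡ suc (2 * (2 * N))

1mod4⇒Odd : ∀ {n} → 1mod4 n → Odd n
1mod4⇒Odd (N , eq) = 2 * N , eq

odd>0 : ∀ {n} → Odd n → 0 < n
odd>0 (_ , refl) = s≤s z≤n

odd-* : ∀ {m n} → Odd m → Odd n → Odd (m * n)
odd-* (M , refl) (N , refl) = M + N * suc (2 * M) , odd-*-odd M N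

odd-+-4* : ∀ {n} → Odd n → ∀ k → Odd (n + 4 * k)
odd-+-4* (N , refl) k = N + 2 * k , eq N k
  where eq : ∀ N k → suc (2 * N) + 4 * k ≡ suc (2 * (N + 2 * k))
        eq = solveℕ-∀

1mod4-+-4* : ∀ {n} → 1mod4 n → ∀ k → 1mod4 (n + 4 * k)
1mod4-+-4* (N , refl) k = N + k , eq N k
  where eq : ∀ N k → suc (2 * (2 * N)) + 4 * k ≡ suc (2 * (2 * (N + k)))
        eq = solveℕ-∀

odd-square-root : ∀ {k} → Odd (k * k) → Odd k
odd-square-root {k} (N , eq) with parity k
... | inj₂ odd        = odd
... | inj₁ (l , refl) = contradiction (trans (sym (*-assoc 2 l (2 * l))) eq) (even≢odd (l * (2 * l)) N)

odd-kronecker-trit : ∀ a {n} → Odd n → Trit (kronecker a n)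
odd-kronecker-trit a (N , refl) = jacobi-trit a N

odd-kronecker-* : ∀ a b {n} → Odd n → kronecker (+ (a * b)) n ≡ kronecker (+ a) n *ℤ kronecker (+ b) n
odd-kronecker-* a b (N , refl) = jacobi-*ℕ a b N

odd-kronecker-shift : ∀ a k {n} → Odd n → kronecker (+ (a + k * n)) n ≡ kronecker (+ a) n
odd-kronecker-shift a k {n} (N , refl) = jacobi-≋ N (shift-≋ a k n)

trit-square≢-1 : ∀ {t} → Trit t → t *ℤ t ≢ -[1+ 0 ]
trit-square≢-1 trit-0 ()
trit-square≢-1 trit-+ ()
trit-square≢-1 trit-- ()

-- By multiplicativity a square in either entry makes the symbol the square of 0, 1 or -1. In the
-- lower entry, k is odd because k² is.
kronecker≡-1⇒nonsquare : ∀ m n → Odd n → kronecker (+ m) n ≡ -[1+ 0 ] → ¬ IsSquare m × ¬ IsSquare n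
kronecker≡-1⇒nonsquare m n odd eq =
  (λ { (k , refl) → trit-square≢-1 (odd-kronecker-trit (+ k) odd) (trans (sym (odd-kronecker-* k k odd)) eq) }) ,
  (λ { (k , refl) → let odd-k = odd-square-root odd in
       trit-square≢-1 (odd-kronecker-trit (+ m) odd-k)
         (trans (sym (kronecker-*ʳ (+ m) k k (odd>0 odd-k) (odd>0 odd-k))) eq) })

module Transfer (a b c d κ x η : ℕ) (a≡1 : 1mod4 a) (d≡1 : 1mod4 d) (c≡4κ : c ≡ 4 * κ)
  (det : a * d ≡ b * c + 1) (b/d≡1 : kronecker (+ b) d ≡ + 1) (odd-x : Odd x) (0<η : 0 < η) where
  open ≡-Reasoning

  y u v w : ℕ
  y = 4 * η
  u = a * x + b * y
  v = c * x + d * y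
  w = κ * x + d * η

  v≡4w : v ≡ 4 * w
  v≡4w = trans (cong (λ c → c * x + d * y) c≡4κ) (eq κ x d η)
    where eq : ∀ κ x d η → 4 * κ * x + d * (4 * η) ≡ 4 * (κ * x + d * η)
          eq = solveℕ-∀

  0<w : 0 < w
  0<w = ≤-trans (*-mono-≤ (odd>0 (1mod4⇒Odd d≡1)) 0<η) (m≤n+m (d * η) (κ * x))

  noCommonPrime : NoCommonPrime a c
  noCommonPrime {p} pp p∣a p∣c = >⇒≢ (prime≥2 pp) (∣1⇒≡1 (∣m+n∣m⇒∣n (subst (p ∣_) det (∣m⇒∣m*n d p∣a)) (∣n⇒∣m*n b p∣c)))

  odd-u : Odd u
  odd-u = subst Odd (cong (_+_ (a * x)) (eq b η)) (odd-+-4* (odd-* (1mod4⇒Odd a≡1) odd-x) (b * η))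
    where eq : ∀ b η → 4 * (b * η) ≡ b * (4 * η)
          eq = solveℕ-∀

  -- Left multiplication by an upper unipotent matrix changes neither (v/u) nor (b/d);
  -- it serves to make a prime to y.
  module _ (t : ℕ) (a′⊥y : NoCommonPrime (a + t * c) y) where
    a′ b′ u′ : ℕ
    a′ = a + t * c
    b′ = b + t * d
    u′ = u + t * v

    det′ : a′ * d ≡ b′ * c + 1
    det′ = trans (*-distribʳ-+ d a (t * c)) (trans (cong (_+ t * c * d) det) (eq b c d t))
      where eq : ∀ b c d t → b * c + 1 + t * c * d ≡ (b + t * d) * c + 1
            eq = solveℕ-∀

    u′≡ : u′ ≡ a′ * x + b′ * y
    u′≡ = eq a b c d t x y
      where eq : ∀ a b c d t x y → a * x + b * y + t * (c * x + d * y) ≡ (a + t * c) * x + (b + t * d) * y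
            eq = solveℕ-∀

    a′≡1 : 1mod4 a′
    a′≡1 = subst 1mod4 (cong (_+_ a) (trans (eq t κ) (cong (t *_) (sym c≡4κ)))) (1mod4-+-4* a≡1 (t * κ))
      where eq : ∀ t κ → 4 * (t * κ) ≡ t * (4 * κ)
            eq = solveℕ-∀

    odd-a′ : Odd a′
    odd-a′ = 1mod4⇒Odd a′≡1

    odd-u′ : Odd u′
    odd-u′ = subst Odd (cong (_+_ u) (trans (eq t w) (cong (t *_) (sym v≡4w)))) (odd-+-4* odd-u (t * w))
      where eq : ∀ t w → 4 * (t * w) ≡ t * (4 * w)
            eq = solveℕ-∀

    v/u′≡v/u : kronecker (+ v) u′ ≡ kronecker (+ v) u
    v/u′≡v/u = go odd-u
      where
      go : Odd u → kronecker (+ v) u′ ≡ kronecker (+ v) u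
      go (U , u≡) = subst₂ (λ v u → kronecker (+ v) (u + t * v) ≡ kronecker (+ v) u) (sym v≡4w) (sym u≡)
        (jacobi-period-4* w U t 0<w)

    a′v≡ : a′ * v ≡ y + c * u′
    a′v≡ = begin
      a′ * (c * x + d * y)             ≡⟨ eq₁ a′ c x d y ⟩
      c * (a′ * x) + (a′ * d) * y      ≡⟨ cong (λ z → c * (a′ * x) + z * y) det′ ⟩
      c * (a′ * x) + (b′ * c + 1) * y  ≡⟨ eq₂ c (a′ * x) b′ y ⟩
      y + c * (a′ * x + b′ * y)        ≡⟨ cong (λ z → y + c * z) u′≡ ⟨
      y + c * u′ ∎
      where
      eq₁ : ∀ a c x d y → a * (c * x + d * y) ≡ c * (a * x) + (a * d) * y
      eq₁ = solveℕ-∀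
      eq₂ : ∀ c z b y → c * z + (b * c + 1) * y ≡ y + c * (z + b * y)
      eq₂ = solveℕ-∀

    a′/u′*v/u′ : kronecker (+ a′) u′ *ℤ kronecker (+ v) u′ ≡ kronecker (+ y) u′
    a′/u′*v/u′ = begin
      kronecker (+ a′) u′ *ℤ kronecker (+ v) u′   ≡⟨ odd-kronecker-* a′ v odd-u′ ⟨
      kronecker (+ (a′ * v)) u′                   ≡⟨ cong (λ z → kronecker (+ z) u′) a′v≡ ⟩
      kronecker (+ (y + c * u′)) u′               ≡⟨ odd-kronecker-shift y c odd-u′ ⟩
      kronecker (+ y) u′ ∎

    a′/u′ : kronecker (+ a′) u′ ≡ kronecker (+ b′) a′ *ℤ kronecker (+ y) a′
    a′/u′ = begin
      kronecker (+ a′) u′                          ≡⟨ go a′≡1 ⟩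
      kronecker (+ u′) a′                          ≡⟨ cong (λ z → kronecker (+ z) a′) (trans u′≡ (eq a′ x (b′ * y))) ⟩
      kronecker (+ (b′ * y + x * a′)) a′           ≡⟨ odd-kronecker-shift (b′ * y) x odd-a′ ⟩
      kronecker (+ (b′ * y)) a′                    ≡⟨ odd-kronecker-* b′ y odd-a′ ⟩
      kronecker (+ b′) a′ *ℤ kronecker (+ y) a′ ∎
      where
      eq : ∀ a x z → a * x + z ≡ z + x * a
      eq = solveℕ-∀
      go : 1mod4 a′ → kronecker (+ a′) u′ ≡ kronecker (+ u′) a′
      go (α , a′≡) = subst (λ n → kronecker (+ n) u′ ≡ kronecker (+ u′) n) (sym a′≡) (reciprocity-1mod4 α u′ (odd>0 odd-u′))

    y/u′ : kronecker (+ y) u′ ≡ kronecker (+ y) a′ *ℤ kronecker (+ y) x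
    y/u′ = begin
      kronecker (+ y) u′                            ≡⟨ cong (kronecker (+ y)) u′≡ ⟩
      kronecker (+ y) (a′ * x + b′ * y)             ≡⟨ go (odd-* odd-a′ odd-x) ⟩
      kronecker (+ y) (a′ * x)                      ≡⟨ kronecker-*ʳ (+ y) a′ x (odd>0 odd-a′) (odd>0 odd-x) ⟩
      kronecker (+ y) a′ *ℤ kronecker (+ y) x ∎
      where
      go : Odd (a′ * x) → kronecker (+ y) (a′ * x + b′ * y) ≡ kronecker (+ y) (a′ * x)
      go (N , eq) = subst (λ n → kronecker (+ y) (n + b′ * y) ≡ kronecker (+ y) n) (sym eq) (jacobi-period-4* η N b′ 0<η)

    b′/a′d≡1 : kronecker (+ b′) (a′ * d) ≡ + 1
    b′/a′d≡1 = trans (cong (kronecker (+ b′)) det′) (go b′)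
      where
      eq : ∀ b κ → b * (4 * κ) + 1 ≡ 1 + κ * (4 * b)
      eq = solveℕ-∀
      go : ∀ b → kronecker (+ b) (b * c + 1) ≡ + 1
      -- The period law needs a positive upper entry; for 0 the lower entry is 1 and the symbol
      -- (0/1) is 1.
      go zero    = refl
      go (suc b) = trans (cong (kronecker (+ suc b)) (trans (cong (λ c → suc b * c + 1) c≡4κ) (eq (suc b) κ)))
        (trans (jacobi-period (suc b) 0 κ (s≤s z≤n)) (kronecker-1 (+ suc b)))

    b′/a′≡1 : kronecker (+ b′) a′ ≡ + 1
    b′/a′≡1 = begin
      kronecker (+ b′) a′                            ≡⟨ ℤₚ.*-identityʳ _ ⟨
      kronecker (+ b′) a′ *ℤ + 1                     ≡⟨ cong (kronecker (+ b′) a′ *ℤ_) (trans (odd-kronecker-shift b t (1mod4⇒Odd d≡1)) b/d≡1) ⟨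
      kronecker (+ b′) a′ *ℤ kronecker (+ b′) d      ≡⟨ kronecker-*ʳ (+ b′) a′ d (odd>0 odd-a′) (odd>0 (1mod4⇒Odd d≡1)) ⟨
      kronecker (+ b′) (a′ * d)                      ≡⟨ b′/a′d≡1 ⟩
      + 1 ∎

    v/u≡y/x-via-t : kronecker (+ v) u ≡ kronecker (+ y) x
    v/u≡y/x-via-t = ℤₚ.*-cancelˡ-≡ (kronecker (+ y) a′) _ _ {{≢-nonZero (y/a′≢0 odd-a′)}} (begin
      kronecker (+ y) a′ *ℤ kronecker (+ v) u                            ≡⟨ cong (kronecker (+ y) a′ *ℤ_) v/u′≡v/u ⟨
      kronecker (+ y) a′ *ℤ kronecker (+ v) u′                           ≡⟨ cong (_*ℤ kronecker (+ v) u′) (ℤₚ.*-identityˡ (kronecker (+ y) a′)) ⟨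
      + 1 *ℤ kronecker (+ y) a′ *ℤ kronecker (+ v) u′                    ≡⟨ cong (λ z → z *ℤ kronecker (+ y) a′ *ℤ kronecker (+ v) u′) b′/a′≡1 ⟨
      kronecker (+ b′) a′ *ℤ kronecker (+ y) a′ *ℤ kronecker (+ v) u′    ≡⟨ cong (_*ℤ kronecker (+ v) u′) a′/u′ ⟨
      kronecker (+ a′) u′ *ℤ kronecker (+ v) u′                          ≡⟨ a′/u′*v/u′ ⟩
      kronecker (+ y) u′                                                 ≡⟨ y/u′ ⟩
      kronecker (+ y) a′ *ℤ kronecker (+ y) x ∎)
      where
      y/a′≢0 : Odd a′ → kronecker (+ y) a′ ≢ + 0
      y/a′≢0 (N , eq) = subst (λ n → kronecker (+ y) n ≢ + 0) (sym eq)
        (jacobi-nonzero y N (subst (λ n → NoCommonPrime n y) eq a′⊥y))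

  v/u≡y/x : kronecker (+ v) u ≡ kronecker (+ y) x
  v/u≡y/x with coprime-translate a c noCommonPrime y (*-mono-≤ {1} {4} (s≤s z≤n) 0<η)
  ... | t , a′⊥y = v/u≡y/x-via-t t a′⊥y

-- Residue conditions and the three cases

%2≡1⇒Odd : ∀ n → n % 2 ≡ 1 → Odd n
%2≡1⇒Odd n eq = n / 2 , trans (m≡m%n+[m/n]*n n 2) (cong₂ _+_ eq (*-comm (n / 2) 2))

%4≡1⇒1mod4 : ∀ n → n % 4 ≡ 1 → 1mod4 n
%4≡1⇒1mod4 n eq = n / 4 , trans (m≡m%n+[m/n]*n n 4) (trans (cong (_+ n / 4 * 4) eq) (shape (n / 4)))
  where shape : ∀ q → 1 + q * 4 ≡ suc (2 * (2 * q))
        shape = solveℕ-∀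

%4≡3⇒ : ∀ n → n % 4 ≡ 3 → ∃ λ N → n ≡ suc (2 * suc (2 * N))
%4≡3⇒ n eq = n / 4 , trans (m≡m%n+[m/n]*n n 4) (trans (cong (_+ n / 4 * 4) eq) (shape (n / 4)))
  where shape : ∀ q → 3 + q * 4 ≡ suc (2 * suc (2 * q))
        shape = solveℕ-∀

%4≡0⇒ : ∀ n → n % 4 ≡ 0 → ∃ λ k → n ≡ 4 * k
%4≡0⇒ n eq = n / 4 , trans (m≡m%n+[m/n]*n n 4) (trans (cong (_+ n / 4 * 4) eq) (*-comm (n / 4) 4))

Ψ⇒b/d≡1 : ∀ γ → InΨ γ → kronecker (+ b γ) (d γ) ≡ + 1
Ψ⇒b/d≡1 γ (_ , inv) = trans (sym (cong₂ (λ m n → kronecker (+ m) n) (eq (a γ) (b γ)) (eq (c γ) (d γ)))) (sym (inv 0 1 refl))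
  where eq : ∀ a b → a * 0 + b * 1 ≡ b
        eq = solveℕ-∀

denominator-odd : ∀ γ → InΓ₁4 γ → ∀ x y → Odd y → Odd (denom γ x y)
denominator-odd γ (_ , d≡1 , c≡0) x y odd-y with %4≡0⇒ (c γ) c≡0
... | κ , c≡4κ = subst Odd (trans (+-comm (d γ * y) (4 * (κ * x))) (cong (_+ d γ * y) (trans (sym (*-assoc 4 κ x)) (cong (_* x) (sym c≡4κ)))))
  (odd-+-4* (odd-* (1mod4⇒Odd (%4≡1⇒1mod4 (d γ) d≡1)) odd-y) (κ * x))

nonsquare-even-denominator : ∀ γ → InΨ γ → ∀ x η → Odd x → 0 < η → kronecker (+ (4 * η)) x ≡ -[1+ 0 ] →
  ¬ IsSquare (numer γ x (4 * η)) × ¬ IsSquare (denom γ x (4 * η))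
nonsquare-even-denominator γ ψ@((a≡1 , d≡1 , c≡0) , _) x η odd-x 0<η y/x≡-1 with %4≡0⇒ (c γ) c≡0
-- The odd entry is the numerator u, so the symbol in question is (v/u) and the two conclusions
-- arrive in reverse order.
... | κ , c≡4κ = swap (kronecker≡-1⇒nonsquare v u odd-u (trans v/u≡y/x y/x≡-1))
  where open Transfer (a γ) (b γ) (c γ) (d γ) κ x η (%4≡1⇒1mod4 (a γ) a≡1) (%4≡1⇒1mod4 (d γ) d≡1)
          c≡4κ (det γ) (Ψ⇒b/d≡1 γ ψ) odd-x 0<η

-- Excludes y = 0, which also satisfies 4 ∣ y, before reciprocity asks for a positive y.
kronecker-0 : ∀ x → kronecker (+ x) 0 ≢ -[1+ 0 ]
kronecker-0 zero          ()
kronecker-0 (suc zero)    ()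
kronecker-0 (suc (suc x)) ()

theorem2p5 : (x y : ℕ) → Coprime x y → Cond x y →
    (γ : Mat) → InΨ γ →
    ¬ IsSquare (numer γ x y) × ¬ IsSquare (denom γ x y)
theorem2p5 x y _ (inj₁ (y%2≡1 , x/y≡-1)) γ (γ∈Γ₁4 , inv) =
  kronecker≡-1⇒nonsquare (numer γ x y) (denom γ x y) (denominator-odd γ γ∈Γ₁4 x y (%2≡1⇒Odd y y%2≡1))
    (trans (sym (inv x y y%2≡1)) x/y≡-1)
theorem2p5 x y _ (inj₂ (inj₁ (x%4≡1 , y%4≡0 , x/y≡-1))) γ ψ with %4≡1⇒1mod4 x x%4≡1 | %4≡0⇒ y y%4≡0
... | _ | zero , refl = contradiction x/y≡-1 (kronecker-0 x)
... | M , refl | η@(suc _) , refl = nonsquare-even-denominator γ ψ x η (2 * M , refl) (s≤s z≤n)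
  (trans (sym (reciprocity-1mod4 M (4 * η) (s≤s z≤n))) x/y≡-1)
theorem2p5 x y _ (inj₂ (inj₂ (x%4≡3 , y%4≡0 , x/y≡))) γ ψ with %4≡3⇒ x x%4≡3 | %4≡0⇒ y y%4≡0
-- (-1/0) = 1, so at y = 0 this condition too demands (x/0) = -1.
... | _ | zero , refl = contradiction x/y≡ (kronecker-0 x)
... | M , refl | η@(suc _) , refl = nonsquare-even-denominator γ ψ x η (suc (2 * M) , refl) (s≤s z≤n) (begin
  kronecker (+ (4 * η)) x                                            ≡⟨ reciprocity-3mod4 M (4 * η) (s≤s z≤n) ⟨
  kronecker (+ x) (4 * η) *ℤ kronecker -[1+ 0 ] (4 * η)              ≡⟨ cong (_*ℤ kronecker -[1+ 0 ] (4 * η)) x/y≡ ⟩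
  - kronecker -[1+ 0 ] (4 * η) *ℤ kronecker -[1+ 0 ] (4 * η)         ≡⟨ ℤₚ.neg-distribˡ-* (kronecker -[1+ 0 ] (4 * η)) _ ⟨
  - (kronecker -[1+ 0 ] (4 * η) *ℤ kronecker -[1+ 0 ] (4 * η))       ≡⟨ cong -_ (square (4 * η) (s≤s z≤n)) ⟩
  -[1+ 0 ] ∎)
  where
  open ≡-Reasoning
  square : ∀ n → 0 < n → kronecker -[1+ 0 ] n *ℤ kronecker -[1+ 0 ] n ≡ + 1
  square = odd-part-induction _
    (λ N → trans (cong (λ z → z *ℤ z) (jacobi--1 N)) (sgn-square N))
    (λ m 0<m ih → trans (cong (λ z → z *ℤ z) (trans (kronecker-double -[1+ 0 ] m 0<m) (ℤₚ.*-identityˡ _))) ih)
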